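{- Let $n\ge 1$, $r\ge 2$ and $s\ge 0$ be integers and let $\mathcal{F}$ be a family of non-empty subsets of $[n]$ such that $s<|F|$ for every $F\in\mathcal{F}$. Then $$\chi(\mathrm{KG}^r(\mathcal{F},s))\ge \left\lceil\frac{\mathrm{ecd}^r(\mathcal{F},\lfloor s/2\rfloor)}{r-1}\right\rceil.$$
   Context: $\mathrm{KG}^r(\mathcal{F},s)$ is the $r$-uniform hypergraph whose vertex set is $\mathcal{F}$ and whose edges are all $r$-subsets $\{F_1,\dots,F_r\}$ of $\mathcal{F}$ with $|F_i\cap F_j|\le s$ for all $1\le i<j\le r$. $\chi$ denotes the chromatic number (minimum number of colors in a vertex coloring with no monochromatic edge). For $s'\ge 0$ and $A,B\subseteq[n]$, write $A\subseteq_{s'}B$ if there is a set $E$ with $|E|\le s'$ and $A\setminus E\subseteq B$. An equitable partition of a set $X$ into $r$ parts is a partition $X=X_1\cup\dots\cup X_r$ (parts possibly empty) with $||X_i|-|X_j||\le 1$ for all $i,j$. $\mathrm{ecd}^r(\mathcal{F},s')$ is the minimum size of a set $X_0\subseteq[n]$ such that there is an equitable partition $[n]\setminus X_0=X_1\cup\dots\cup X_r$ with no $F\in\mathcal{F}$ and $i\in\{1,\dots,r\}$ satisfying $F\subseteq_{s'}X_i$. -}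

module Defs where

open import Data.Nat using (ℕ; zero; suc; _+_; _≤_; _/_)
open import Data.Fin using (Fin)
open import Data.Fin.Subset using (Subset; _∩_; _─_; _⊆_; ∣_∣)
open import Data.Vec using (tabulate)
open import Data.Product using (Σ; _×_; ∃)
open import Relation.Nullary using (¬_; does)
open import Relation.Binary.PropositionalEquality using (_≡_)
open import Function.Definitions using (Injective)
import Data.Fin as Fin

Family : ℕ → Set₁
Family n = Subset n → Set

IsEdge : ∀ {n} (r s : ℕ) (𝓕 : Family n) → (Fin r → Subset n) → Set
IsEdge r s 𝓕 e =
  Injective _≡_ _≡_ e × (∀ i → 𝓕 (e i)) ×
  (∀ i j → ¬ i ≡ j → ∣ e i ∩ e j ∣ ≤ s)

-- A proper k-colouring of KG^r(𝓕,s): a colour for every subset of [n]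
-- (colours of sets outside 𝓕 are irrelevant) with no monochromatic edge.
ProperColouring : ∀ {n} (r s : ℕ) (𝓕 : Family n) (k : ℕ) → (Subset n → Fin k) → Set
ProperColouring {n} r s 𝓕 k c =
  ∀ (e : Fin r → Subset n) → IsEdge r s 𝓕 e → ¬ (∀ i j → c (e i) ≡ c (e j))

_⊆[_]_ : ∀ {n} → Subset n → ℕ → Subset n → Set
_⊆[_]_ {n} A s' B = Σ (Subset n) λ E → ∣ E ∣ ≤ s' × (A ─ E) ⊆ B

-- A partition [n] = X₀ ∪ X₁ ∪ … ∪ X_r (parts possibly empty) is encoded by a
-- labelling lab : Fin n → Fin (suc r); part j is the set of points labelled j,
-- label zero is X₀ and label (suc i) is X_{i+1}.
part : ∀ {n r} → (Fin n → Fin (suc r)) → Fin (suc r) → Subset n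
part lab j = tabulate λ x → does (lab x Fin.≟ j)

Equitable : ∀ {n r} → (Fin n → Fin (suc r)) → Set
Equitable {r = r} lab = ∀ (i j : Fin r) → ∣ part lab (Fin.suc i) ∣ ≤ suc ∣ part lab (Fin.suc j) ∣

Admissible : ∀ {n} (r s' : ℕ) (𝓕 : Family n) → (Fin n → Fin (suc r)) → Set
Admissible {n} r s' 𝓕 lab =
  Equitable lab × (∀ (F : Subset n) (i : Fin r) → 𝓕 F → ¬ (F ⊆[ s' ] part lab (Fin.suc i)))

IsEcd : ∀ {n} (r s' : ℕ) (𝓕 : Family n) → ℕ → Set
IsEcd r s' 𝓕 m =
  (∃ λ lab → Admissible r s' 𝓕 lab × ∣ part lab Fin.zero ∣ ≡ m) ×
  (∀ lab → Admissible r s' 𝓕 lab → m ≤ ∣ part lab Fin.zero ∣)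

-- Ceiling division ⌈ m / d ⌉ for d ≥ 1 (value for d = 0 is irrelevant).
⌈_/_⌉ : ℕ → ℕ → ℕ
⌈ m / zero ⌉ = zero
⌈ m / suc d ⌉ = (m + d) / suc d

{-# OPTIONS --safe #-}

-- Deleting up to ⌊s/2⌋ elements from every member of 𝓕 turns almost disjoint sets into disjoint
-- ones, so it is enough to bound, for upward closed properties "S contains a set of colour j",
-- the number of points to remove for an equitable partition into r parts without any of these
-- properties, unless one of them holds on r disjoint sets. The bound is multiplicative in r, so
-- r = p may be taken prime. If it fails, the nonzero vectors in (ℤ/p ∪ {0})ⁿ, read as p disjoint
-- subsets of [n], map monotonically and equivariantly to ℤ/p × {1 < … < n − 1}: the rank counts
-- the elements of an almost equitable subvector or the pairs (colour, part) that satisfy the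
-- property, and the sign is the mean mod p of a set of parts. No such map exists: the powers of
-- the Bockstein class in the cohomology of ℤ/p pair to 1 mod p with explicit chains of flags of
-- vectors, whereas a flag of n vectors repeats a rank, so the normalised cocycle vanishes on it.

module Submission where

open import Defs
open import Data.Nat using (ℕ; _≤_; _<_; _∸_; ⌊_/2⌋)
open import Data.Fin using (Fin)
open import Data.Fin.Subset using (Subset; ∣_∣; Nonempty)

open import Data.Bool using (Bool; true; false; if_then_else_)
open import Data.Empty using (⊥)
open import Data.Fin as Fin using (zero; suc; toℕ; fromℕ<; combine; _↑ˡ_; _↑ʳ_)
import Data.Fin.Properties as Fin
open import Data.Fin.Permutation using (permutation)
open import Data.Fin.Subset as Subset using (_∈_; _⊆_; _∪_; _∩_)
open import Data.Fin.Subset.Properties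
  using (p⊆q⇒∣p∣≤∣q∣; ∣⊥∣≡0; ∣p∣≤n; ∉⊥; ⊆-antisym; _∈?_; x∈p∩q⁻; x∈p∪q⁺; x∈p∧x∉q⇒x∈p─q; ∩-idem)
import Data.Integer.Properties as ℤ
import Data.Integer.Divisibility.Signed as ℤ∣
open import Data.List using (List; []; _∷_; map; length)
import Data.List.Properties as List
open import Data.List.Relation.Unary.All as All using (All; []; _∷_)
import Data.List.Relation.Unary.All.Properties as All
open import Data.List.Relation.Unary.Linked as Linked using (Linked; []; [-]; _∷_)
import Data.List.Relation.Unary.Linked.Properties as Linked
open import Data.Nat as ℕ using (zero; suc; s≤s; z≤n; z<s; pred; NonZero; ⌈_/2⌉; _⊓_; _≥_; _<?_; _≤?_)
open import Data.Nat.Properties as ℕ using (+-*-semiring)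
open import Data.Nat.Coprimality using (prime⇒coprime; coprime-Bézout)
open import Data.Nat.Divisibility using (∣1⇒≡1)
open import Data.Nat.DivMod
  using (_%_; m%n<n; m<n⇒m%n≡m; n%n≡0; m%n%n≡m%n; [m+kn]%n≡m%n; %-distribˡ-+; m<n*o⇒m/o<n)
open import Data.Nat.GCD using (module Bézout)
open import Data.Nat.ListAction using (product)
open import Data.Nat.Primality using (Prime; ¬prime[0]; ¬prime[1]; productOfPrimes≢0)
open import Data.Nat.Primality.Factorisation using (factorise; PrimeFactorisation)
open import Data.Product using (∃; _×_; _,_; proj₁; proj₂)
open import Data.Sum using (_⊎_; inj₁; inj₂; reduce)
open import Data.Vec as Vec using (Vec; []; _∷_; lookup; tabulate; here; there)
import Data.Vec.Properties as Vec
open import Data.Vec.Relation.Binary.Pointwise.Inductive as Pointwise using (Pointwise; []; _∷_)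
open import Data.Vec.Relation.Unary.Any using (Any; here; there)
open import Function using (_∘_; id)
open import Relation.Binary.Definitions using (Total; Transitive)
open import Relation.Binary.PropositionalEquality
open import Relation.Nullary using (¬_; Dec; does; yes; no; contradiction)
open import Relation.Nullary.Decidable using (_×-dec_; dec-true; dec-false; decidable-stable; ¬¬-excluded-middle)
open import Algebra.Properties.Semiring.Sum +-*-semiring
  using (sum; sum-cong-≗; ∑-distrib-+; *-distribˡ-sum; sum-permute)

-- The sign rests on one fact: a set of residues mod p that is neither empty nor full has a size
-- invertible mod p, so its mean exists and rotates with it. The ranks have no slack. On n + 1
-- points at most (p - 1)t pairs (colour, part) hold, since p parts of one colour would form the
-- disjoint family; and a vector without such pairs whose almost equitable subvector has more than n
-- - (p - 1)t elements would yield the labelling sought, with at most (p - 1)t points removed. Hence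
-- n ranks, one fewer than the vectors of a longest flag. Equivariance holds for nonzero vectors
-- only, so cochains, which are functions on all lists, are compared on flags alone. The properties
-- are arbitrary predicates, so the bound is proved under double negation, removed at the end
-- because an inequality of numbers is decidable. In the multiplicative step the difficulty is
-- equitability: all outer parts must lose points up to one common limit.

module Counting where
  open import Data.Nat using (_+_; _*_)
  open import Data.Nat.Properties

  -- Finite sums of natural numbers

  sum-mono : ∀ {n} {f g : Fin n → ℕ} → (∀ i → f i ≤ g i) → sum f ≤ sum g
  sum-mono {zero}  le = z≤n
  sum-mono {suc n} le = +-mono-≤ (le zero) (sum-mono (le ∘ suc))

  +-mono-≡ : ∀ {a b c d} → a ≤ b → c ≤ d → a + c ≡ b + d → a ≡ b × c ≡ d
  +-mono-≡ {a} {b} {c} {d} a≤b c≤d e =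
    ≤-antisym a≤b (+-cancelʳ-≤ c b a (≤-trans (+-monoʳ-≤ b c≤d) (≤-reflexive (sym e)))) ,
    ≤-antisym c≤d (+-cancelˡ-≤ a d c (≤-trans (+-monoˡ-≤ d a≤b) (≤-reflexive (sym e))))

  -- This turns an equality of ranks into equality of all levels and all colour sets.
  sum-mono-≡ : ∀ {n} {f g : Fin n → ℕ} → (∀ i → f i ≤ g i) → sum f ≡ sum g → ∀ i → f i ≡ g i
  sum-mono-≡ le e zero    = proj₁ (+-mono-≡ (le zero) (sum-mono (le ∘ suc)) e)
  sum-mono-≡ le e (suc i) = sum-mono-≡ (le ∘ suc) (proj₂ (+-mono-≡ (le zero) (sum-mono (le ∘ suc)) e)) i

  sum-mono-< : ∀ {n} {f g : Fin n → ℕ} → (∀ i → f i ≤ g i) → ∀ i → f i < g i → sum f < sum g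
  sum-mono-< le i lt = ≤∧≢⇒< (sum-mono le) λ e → <⇒≢ lt (sum-mono-≡ le e i)

  sum-const : ∀ n c → sum {n} (λ _ → c) ≡ n * c
  sum-const zero    c = refl
  sum-const (suc n) c = cong (c +_) (sum-const n c)

  term≤sum : ∀ {n} (f : Fin n → ℕ) i → f i ≤ sum f
  term≤sum f zero    = m≤m+n _ _
  term≤sum f (suc i) = ≤-trans (term≤sum (f ∘ suc) i) (m≤n+m _ _)

  sum≡0⇒ : ∀ {n} (f : Fin n → ℕ) → sum f ≡ 0 → ∀ i → f i ≡ 0
  sum≡0⇒ f e i = n≤0⇒n≡0 (≤-trans (term≤sum f i) (≤-reflexive e))

  sum>0⇒ : ∀ {n} (f : Fin n → ℕ) → 0 < sum f → ∃ λ i → 0 < f i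
  sum>0⇒ {suc n} f lt with f zero in e
  ... | suc _ = zero , subst (0 <_) (sym e) z<s
  ... | zero  with sum>0⇒ (f ∘ suc) lt
  ...   | i , l = suc i , l

  -- Stated for a total order relation R, so that it gives the minimum for `_≤_` and the maximum for
  -- `_≥_`.
  extremum : ∀ {n} {R : ℕ → ℕ → Set} → Total R → Transitive R →
             (f : Fin (suc n) → ℕ) → ∃ λ i → ∀ j → R (f i) (f j)
  extremum {zero}  tot tr f = zero , λ { zero → reduce (tot (f zero) (f zero)) }
  extremum {suc n} tot tr f with extremum tot tr (f ∘ suc)
  ... | i , le with tot (f zero) (f (suc i))
  ...   | inj₁ l = zero  , λ { zero → reduce (tot (f zero) (f zero)) ; (suc j) → tr l (le j) }
  ...   | inj₂ l = suc i , λ { zero → l ; (suc j) → le j }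

  indicator : Bool → ℕ
  indicator b = if b then 1 else 0

  indicator≤1 : ∀ b → indicator b ≤ 1
  indicator≤1 true  = ≤-refl
  indicator≤1 false = z≤n

  indicator-injective : ∀ {a b} → indicator a ≡ indicator b → a ≡ b
  indicator-injective {true}  {true}  _ = refl
  indicator-injective {false} {false} _ = refl

  size : ∀ {n} → (Fin n → Bool) → ℕ
  size S = sum (indicator ∘ S)

  size≤ : ∀ {n} (S : Fin n → Bool) → size S ≤ n
  size≤ {n} S = ≤-trans (sum-mono (indicator≤1 ∘ S)) (≤-reflexive (trans (sum-const n 1) (*-identityʳ n)))

  size≡n⇒ : ∀ {n} (S : Fin n → Bool) → size S ≡ n → ∀ i → S i ≡ true
  size≡n⇒ {n} S e i = indicator-injective
    (sum-mono-≡ (indicator≤1 ∘ S) (trans e (sym (trans (sum-const n 1) (*-identityʳ n)))) i)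

  size≡0⇒ : ∀ {n} (S : Fin n → Bool) → size S ≡ 0 → ∀ i → S i ≡ false
  size≡0⇒ S e i = indicator-injective (sum≡0⇒ (indicator ∘ S) e i)

  -- Labellings ordered by deletion of points

  Labelling : ℕ → ℕ → Set
  Labelling r n = Vec (Fin (suc r)) n

  module _ {r : ℕ} where

    class : ∀ {n} → Labelling r n → Fin (suc r) → Subset n
    class v e = Vec.map (λ x → does (x Fin.≟ e)) v

    card : ∀ {n} → Labelling r n → Fin (suc r) → ℕ
    card v e = ∣ class v e ∣

    card-hit : ∀ {n} x (v : Labelling r n) → card (x ∷ v) x ≡ suc (card v x)
    card-hit x v rewrite dec-true (x Fin.≟ x) refl = refl

    card-miss : ∀ {n x e} (v : Labelling r n) → ¬ x ≡ e → card (x ∷ v) e ≡ card v e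
    card-miss {x = x} {e} v x≢e rewrite dec-false (x Fin.≟ e) x≢e = refl

    card-∷ : ∀ {n} x (v : Labelling r n) e → card (x ∷ v) e ≡ indicator (does (x Fin.≟ e)) + card v e
    card-∷ x v e with does (x Fin.≟ e)
    ... | true  = refl
    ... | false = refl

    ∈-class⁺ : ∀ {n} (v : Labelling r n) {e x} → lookup v x ≡ e → x ∈ class v e
    ∈-class⁺ v {e} {x} l = Vec.lookup⇒[]= x (class v e)
      (trans (Vec.lookup-map x _ v) (dec-true (_ Fin.≟ e) l))

    ∈-class⁻ : ∀ {n} (v : Labelling r n) {e x} → x ∈ class v e → lookup v x ≡ e
    ∈-class⁻ v {e} {x} i with lookup v x Fin.≟ e
      | trans (sym (Vec.lookup-map x (λ x → does (x Fin.≟ e)) v)) (Vec.[]=⇒lookup i)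
    ... | yes l | _ = l

    class-disjoint : ∀ {n} (v : Labelling r n) {e e′ x} → ¬ e ≡ e′ → x ∈ class v e → ¬ x ∈ class v e′
    class-disjoint v ne i i′ = ne (trans (sym (∈-class⁻ v i)) (∈-class⁻ v i′))

    indicator-sum : ∀ {m} (x : Fin m) → sum (λ e → indicator (does (x Fin.≟ e))) ≡ 1
    indicator-sum {suc m} zero    = cong suc (trans (sum-cong-≗ {m} (λ _ → refl)) (trans (sum-const m 0) (*-zeroʳ m)))
    indicator-sum {suc m} (suc x) = trans (sum-cong-≗ {m} (λ e → refl)) (indicator-sum x)

    sum-card : ∀ {n} (v : Labelling r n) → sum (card v) ≡ n
    sum-card []      = trans (sum-const (suc r) 0) (*-zeroʳ (suc r))
    sum-card (x ∷ v) = trans (sum-cong-≗ (card-∷ x v))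
      (trans (∑-distrib-+ (λ e → indicator (does (x Fin.≟ e))) (card v)) (cong₂ _+_ (indicator-sum x) (sum-card v)))

    -- The flat order with bottom `zero`; thus `v ≼ w` says that v arises from w by deleting points.
    _⊑_ : Fin (suc r) → Fin (suc r) → Set
    x ⊑ y = x ≡ zero ⊎ x ≡ y

    _≼_ : ∀ {n} → Labelling r n → Labelling r n → Set
    _≼_ = Pointwise _⊑_

    ≼-refl : ∀ {n} {v : Labelling r n} → v ≼ v
    ≼-refl = Pointwise.refl (inj₂ refl)

    ≼-trans : ∀ {n} {u v w : Labelling r n} → u ≼ v → v ≼ w → u ≼ w
    ≼-trans = Pointwise.trans λ { (inj₁ e) _ → inj₁ e ; (inj₂ refl) l → l }

    ≼⇒⊆ : ∀ {n} {v w : Labelling r n} → v ≼ w → ∀ i → class v (suc i) ⊆ class w (suc i)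
    ≼⇒⊆ {v = v} {w} le i {x} m with Pointwise.lookup le x | ∈-class⁻ v m
    ... | inj₁ z | l = contradiction (trans (sym z) l) λ ()
    ... | inj₂ s | l = ∈-class⁺ w (trans (sym s) l)

    card-mono : ∀ {n} {v w : Labelling r n} → v ≼ w → ∀ i → card v (suc i) ≤ card w (suc i)
    card-mono le i = p⊆q⇒∣p∣≤∣q∣ (≼⇒⊆ le i)

    -- A proper step of `_≼_` adds a point to some part, which then grows.
    ≼∧card-≡⇒≡ : ∀ {n} {v w : Labelling r n} → v ≼ w → (∀ i → card v (suc i) ≡ card w (suc i)) → v ≡ w
    ≼∧card-≡⇒≡ [] e = refl
    ≼∧card-≡⇒≡ {v = x ∷ v} {_ ∷ w} (inj₂ refl ∷ le) e = cong (x ∷_) (≼∧card-≡⇒≡ le λ i →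
      +-cancelˡ-≡ _ _ _ (trans (sym (card-∷ x v (suc i))) (trans (e i) (card-∷ x w (suc i)))))
    ≼∧card-≡⇒≡ {v = zero ∷ v} {zero ∷ w}  (inj₁ refl ∷ le) e = cong (zero ∷_) (≼∧card-≡⇒≡ le e)
    ≼∧card-≡⇒≡ {v = zero ∷ v} {suc i ∷ w} (inj₁ refl ∷ le) e =
      contradiction (trans (e i) (card-hit (suc i) w)) (<⇒≢ (s≤s (card-mono le i)))

    -- The cap also counts entries labelled `zero`, harmlessly: dropping one puts `zero` back.
    truncate : ∀ {n} → ℕ → Labelling r n → Labelling r n
    truncate c []      = []
    truncate c (x ∷ v) with card (truncate c v) x <? c
    ... | yes _ = x ∷ truncate c v
    ... | no  _ = zero ∷ truncate c v

    truncate-≼ : ∀ {n} c (v : Labelling r n) → truncate c v ≼ v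
    truncate-≼ c []      = []
    truncate-≼ c (x ∷ v) with card (truncate c v) x <? c
    ... | yes _ = inj₂ refl ∷ truncate-≼ c v
    ... | no  _ = inj₁ refl ∷ truncate-≼ c v

    card-truncate : ∀ {n} c (v : Labelling r n) i → card (truncate c v) (suc i) ≡ card v (suc i) ⊓ c
    card-truncate c []      i = refl
    card-truncate c (x ∷ v) i with card (truncate c v) x <? c | x Fin.≟ suc i
    ... | yes lt | yes refl = trans (card-hit x (truncate c v)) (trans (cong suc (card-truncate c v i))
            (small (card v x) (subst (_< c) (card-truncate c v i) lt)))
      where
      small : ∀ a → a ⊓ c < c → suc (a ⊓ c) ≡ suc a ⊓ c
      small a l with ≤-total c a
      ... | inj₁ c≤a = contradiction l (<-irrefl (m≥n⇒m⊓n≡n c≤a))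
      ... | inj₂ a≤c rewrite m≤n⇒m⊓n≡m a≤c = sym (m≤n⇒m⊓n≡m l)
    ... | no ge | yes refl = trans (card-truncate c v i)
            (big (card v x) (subst (λ a → ¬ a < c) (card-truncate c v i) ge))
      where
      big : ∀ a → ¬ a ⊓ c < c → a ⊓ c ≡ suc a ⊓ c
      big a l = trans (m≥n⇒m⊓n≡n (≮⇒≥ λ a<c → l (≤-<-trans (m⊓n≤m a c) a<c)))
                      (sym (m≥n⇒m⊓n≡n (m≤n⇒m≤1+n (≮⇒≥ λ a<c → l (≤-<-trans (m⊓n≤m a c) a<c)))))
    ... | yes _ | no ne = trans (card-miss (truncate c v) ne) (card-truncate c v i)
    ... | no  _ | no ne = card-truncate c v i

    Balanced : ∀ {n} → Labelling r n → Set
    Balanced v = ∀ i j → card v (suc i) ≤ suc (card v (suc j))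

open Counting

module Cohomology where
  open import Data.Integer using (ℤ; +_; -_; _+_; _*_; 0ℤ; 1ℤ; -1ℤ)
  open import Data.Integer.Tactic.RingSolver using (solve-∀)
  import Algebra.Properties.AbelianGroup ℤ.+-0-abelianGroup as ℤ+

  -- Cochains on lists, prisms and cones

  Cochain : Set → Set
  Cochain V = List V → ℤ

  -- The simplicial coboundary, by recursion on the first vertex. The empty list is the simplex of
  -- dimension -1, so the complex is augmented.
  δ : {V : Set} → Cochain V → Cochain V
  δ c []       = 0ℤ
  δ c (x ∷ xs) = c xs + -1ℤ * δ (c ∘ (x ∷_)) xs

  -- Sum, difference and scaling in one operation, so that linearity of an operator is a single
  -- lemma.
  lin : {A : Set} → (A → ℤ) → ℤ → (A → ℤ) → A → ℤ
  lin c k d z = c z + k * d z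

  δ-cong : {V : Set} {c d : Cochain V} → (∀ z → c z ≡ d z) → ∀ z → δ c z ≡ δ d z
  δ-cong e []       = refl
  δ-cong e (x ∷ xs) = cong₂ (λ a b → a + -1ℤ * b) (e xs) (δ-cong (e ∘ (x ∷_)) xs)

  lin-step : ∀ a b k u v → a + k * b + -1ℤ * (u + k * v) ≡ a + -1ℤ * u + k * (b + -1ℤ * v)
  lin-step = solve-∀

  δ-lin : {V : Set} (c : Cochain V) (k : ℤ) (d : Cochain V) →
          ∀ z → δ (lin c k d) z ≡ lin (δ c) k (δ d) z
  δ-lin c k d []       = sym (trans (ℤ.+-identityˡ _) (ℤ.*-zeroʳ k))
  δ-lin c k d (x ∷ xs) =
    trans (cong (λ b → lin c k d xs + -1ℤ * b) (δ-lin (c ∘ (x ∷_)) k (d ∘ (x ∷_)) xs))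
          (lin-step (c xs) (d xs) k _ _)

  δ-map : {V W : Set} (f : V → W) (c : Cochain W) → ∀ z → δ (c ∘ map f) z ≡ δ c (map f z)
  δ-map f c []       = refl
  δ-map f c (x ∷ xs) = cong (λ b → c (map f xs) + -1ℤ * b) (δ-map f (c ∘ (f x ∷_)) xs)

  δ-scale : {V : Set} (k : ℤ) (c : Cochain V) → ∀ z → δ (λ y → k * c y) z ≡ k * δ c z
  δ-scale k c []       = sym (ℤ.*-zeroʳ k)
  δ-scale k c (x ∷ xs) =
    trans (cong (λ b → k * c xs + -1ℤ * b) (δ-scale k (c ∘ (x ∷_)) xs)) (eq k (c xs) _)
    where
    eq : ∀ k a b → k * a + -1ℤ * (k * b) ≡ k * (a + -1ℤ * b)
    eq = solve-∀

  module _ {V W : Set} (i j : V → W) where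

    -- The alternating sum of c over the simplices (i x₀, ..., i xₖ, j xₖ, ..., j xₘ), which
    -- triangulate a simplex times an interval.
    prism : Cochain W → Cochain V
    prism c []       = 0ℤ
    prism c (x ∷ xs) = c (i x ∷ map j (x ∷ xs)) + -1ℤ * prism (c ∘ (i x ∷_)) xs

    -- The lists at which `prism` evaluates its cochain; for flags they are flags again by
    -- `prism-flag`.
    data Prism : List V → List W → Set where
      here  : ∀ {x xs}    → Prism (x ∷ xs) (i x ∷ map j (x ∷ xs))
      there : ∀ {x xs ys} → Prism xs ys → Prism (x ∷ xs) (i x ∷ ys)

    prism-cong : ∀ {c d} z → (∀ {y} → Prism z y → c y ≡ d y) → prism c z ≡ prism d z
    prism-cong []       e = refl
    prism-cong (x ∷ xs) e = cong₂ (λ a b → a + -1ℤ * b) (e here) (prism-cong xs (e ∘ there))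

    prism-lin : ∀ c k d z → prism (lin c k d) z ≡ lin (prism c) k (prism d) z
    prism-lin c k d []       = sym (trans (ℤ.+-identityˡ _) (ℤ.*-zeroʳ k))
    prism-lin c k d (x ∷ xs) =
      trans (cong (λ b → lin c k d (i x ∷ map j (x ∷ xs)) + -1ℤ * b)
                  (prism-lin (c ∘ (i x ∷_)) k (d ∘ (i x ∷_)) xs))
            (lin-step (c _) (d _) k _ _)

    prism-δ : ∀ c z → prism (δ c) z ≡ c (map j z) + -1ℤ * c (map i z) + -1ℤ * δ (prism c) z
    prism-δ c []       = eq (c [])
      where
      eq : ∀ a → 0ℤ ≡ a + -1ℤ * a + -1ℤ * 0ℤ
      eq = solve-∀
    prism-δ c (x ∷ xs) = begin
      c (map j (x ∷ xs)) + -1ℤ * (c (i x ∷ map j xs) + -1ℤ * δ c₂ (map j xs))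
        + -1ℤ * prism (lin c -1ℤ (δ c₁)) xs
        ≡⟨ cong (λ b → c (map j (x ∷ xs)) + -1ℤ * (c (i x ∷ map j xs) + -1ℤ * δ c₂ (map j xs))
                         + -1ℤ * b)
                (trans (prism-lin c -1ℤ (δ c₁) xs)
                       (cong (λ b → prism c xs + -1ℤ * b) (prism-δ c₁ xs))) ⟩
      c (map j (x ∷ xs)) + -1ℤ * (c (i x ∷ map j xs) + -1ℤ * δ c₂ (map j xs))
        + -1ℤ * (prism c xs
                 + -1ℤ * (c₁ (map j xs) + -1ℤ * c₁ (map i xs) + -1ℤ * δ (prism c₁) xs))
        -- The term `c₁ (map j xs)`, the wall between the first two simplices of the prism, cancels.
        ≡⟨ eq (c (map j (x ∷ xs))) (c₁ (map j xs)) (δ c₂ (map j xs)) (prism c xs)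
              (c₁ (map i xs)) (δ (prism c₁) xs) ⟩
      c (map j (x ∷ xs)) + -1ℤ * c₁ (map i xs)
        + -1ℤ * (prism c xs + -1ℤ * (δ c₂ (map j xs) + -1ℤ * δ (prism c₁) xs))
        ≡⟨ cong (λ b → c (map j (x ∷ xs)) + -1ℤ * c₁ (map i xs) + -1ℤ * (prism c xs + -1ℤ * b))
                (sym (trans (δ-lin (c₂ ∘ map j) -1ℤ (prism c₁) xs)
                            (cong (λ b → b + -1ℤ * δ (prism c₁) xs) (δ-map j c₂ xs)))) ⟩
      c (map j (x ∷ xs)) + -1ℤ * c (map i (x ∷ xs)) + -1ℤ * δ (prism c) (x ∷ xs) ∎
      where
      open ≡-Reasoning
      c₁ c₂ : Cochain W
      c₁ = c ∘ (i x ∷_)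
      c₂ = c₁ ∘ (j x ∷_)
      eq : ∀ a b d p e f → a + -1ℤ * (b + -1ℤ * d) + -1ℤ * (p + -1ℤ * (b + -1ℤ * e + -1ℤ * f))
                         ≡ a + -1ℤ * e + -1ℤ * (p + -1ℤ * (d + -1ℤ * f))
      eq = solve-∀

    -- For v below every j x, the dual of a null-homotopy of i (through j, to the constant v).
    cone : W → Cochain W → Cochain V
    cone v c z = c (v ∷ map j z) + -1ℤ * prism c z

    cone-lin : ∀ v c k d z → cone v (lin c k d) z ≡ lin (cone v c) k (cone v d) z
    cone-lin v c k d z =
      trans (cong (λ b → lin c k d (v ∷ map j z) + -1ℤ * b) (prism-lin c k d z))
            (lin-step (c _) (d _) k _ _)

    -- The prism leads from i to j and the vertex v cones off the j end, so the two terms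
    -- `c (map j z)` cancel.
    cone-δ : ∀ v c z → cone v (δ c) z ≡ lin (c ∘ map i) -1ℤ (δ (cone v c)) z
    cone-δ v c z = begin
      c (map j z) + -1ℤ * δ (c ∘ (v ∷_)) (map j z) + -1ℤ * prism (δ c) z
        ≡⟨ cong (λ b → c (map j z) + -1ℤ * δ (c ∘ (v ∷_)) (map j z) + -1ℤ * b) (prism-δ c z) ⟩
      c (map j z) + -1ℤ * δ (c ∘ (v ∷_)) (map j z)
        + -1ℤ * (c (map j z) + -1ℤ * c (map i z) + -1ℤ * δ (prism c) z)
        ≡⟨ eq (c (map j z)) (δ (c ∘ (v ∷_)) (map j z)) (c (map i z)) (δ (prism c) z) ⟩
      c (map i z) + -1ℤ * (δ (c ∘ (v ∷_)) (map j z) + -1ℤ * δ (prism c) z)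
        ≡⟨ cong (λ b → c (map i z) + -1ℤ * b)
                (sym (trans (δ-lin (c ∘ (v ∷_) ∘ map j) -1ℤ (prism c) z)
                            (cong (λ b → b + -1ℤ * δ (prism c) z) (δ-map j (c ∘ (v ∷_)) z)))) ⟩
      c (map i z) + -1ℤ * δ (cone v c) z ∎
      where
      open ≡-Reasoning
      eq : ∀ a b e f → a + -1ℤ * b + -1ℤ * (a + -1ℤ * e + -1ℤ * f)
                     ≡ e + -1ℤ * (b + -1ℤ * f)
      eq = solve-∀

  -- Orbit sums and the rotation of residues

  iter : {A : Set} → (A → A) → ℕ → A → A
  iter f zero    x = x
  iter f (suc k) x = iter f k (f x)

  orbitSum : {A : Set} → (A → A) → ℕ → (A → ℤ) → A → ℤ
  orbitSum f zero    c x = 0ℤ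
  orbitSum f (suc k) c x = c x + orbitSum f k c (f x)

  orbitSum-lin : {A : Set} (f : A → A) (n : ℕ) (c : A → ℤ) (k : ℤ) (d : A → ℤ) → ∀ x →
    orbitSum f n (lin c k d) x ≡ lin (orbitSum f n c) k (orbitSum f n d) x
  orbitSum-lin f zero    c k d x = sym (trans (ℤ.+-identityˡ _) (ℤ.*-zeroʳ k))
  orbitSum-lin f (suc n) c k d x =
    trans (cong (λ b → lin c k d x + b) (orbitSum-lin f n c k d (f x))) (eq (c x) (d x) k _ _)
    where
    eq : ∀ c d k u v → c + k * d + (u + k * v) ≡ c + u + k * (d + v)
    eq = solve-∀

  -- Both sides sum c over the first n + 1 points of the orbit. If `iter f n x` is x, the orbit sum
  -- is therefore invariant.
  orbitSum-shift : {A : Set} (f : A → A) (n : ℕ) (c : A → ℤ) → ∀ x →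
    orbitSum f n c (f x) + c x ≡ orbitSum f n c x + c (iter f n x)
  orbitSum-shift f zero    c x = refl
  orbitSum-shift f (suc n) c x =
    trans (eq (c (f x)) _ (c x))
      (trans (cong (λ b → c x + b) (orbitSum-shift f n c (f x))) (sym (ℤ.+-assoc (c x) _ _)))
    where
    eq : ∀ a b c → a + b + c ≡ c + (b + a)
    eq = solve-∀

  orbitSum-∘ : {A : Set} (f : A → A) (n : ℕ) (c : A → ℤ) → ∀ x →
    orbitSum f n (c ∘ f) x ≡ orbitSum f n c (f x)
  orbitSum-∘ f zero    c x = refl
  orbitSum-∘ f (suc n) c x = cong (λ b → c (f x) + b) (orbitSum-∘ f n c (f x))

  -- The intertwining is required on P only, because sign maps commute with the rotation just on
  -- flags.
  orbitSum-map : {A B : Set} (f : A → A) (g : B → B) (h : A → B) (P : A → Set) →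
    (∀ {x} → P x → P (f x)) → (∀ {x} → P x → h (f x) ≡ g (h x)) →
    ∀ n c {x} → P x → orbitSum f n (c ∘ h) x ≡ orbitSum g n c (h x)
  orbitSum-map f g h P Pf e zero    c px = refl
  orbitSum-map f g h P Pf e (suc n) c px =
    cong (λ b → c (h _) + b) (trans (orbitSum-map f g h P Pf e n c (Pf px)) (cong (orbitSum g n c) (e px)))

  bit : Bool → ℤ
  bit b = if b then 1ℤ else 0ℤ

  module Rotation (q : ℕ) where

    p : ℕ
    p = suc q

    rot : Fin p → Fin p
    rot a = fromℕ< (m%n<n (suc (toℕ a)) p)

    rot-cases : ∀ a → (toℕ a ℕ.< q × toℕ (rot a) ≡ suc (toℕ a)) ⊎ (toℕ a ≡ q × toℕ (rot a) ≡ 0)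
    rot-cases a with ℕ.m≤n⇒m<n∨m≡n (ℕ.≤-pred (Fin.toℕ<n a))
    ... | inj₁ a<q = inj₁ (a<q , trans (Fin.toℕ-fromℕ< _) (m<n⇒m%n≡m (ℕ.s≤s a<q)))
    ... | inj₂ a≡q = inj₂ (a≡q , trans (Fin.toℕ-fromℕ< _) (trans (cong (λ b → suc b % p) a≡q) (n%n≡0 p)))

    iter-rot : ∀ k a → toℕ a ℕ.+ k ℕ.< p → toℕ (iter rot k a) ≡ toℕ a ℕ.+ k
    iter-rot zero    a _ = sym (ℕ.+-identityʳ _)
    iter-rot (suc k) a a+k<p with rot-cases a
    ... | inj₁ (_ , e) = trans (iter-rot k (rot a) (subst (ℕ._< p) eq a+k<p)) (sym eq)
      where eq = trans (ℕ.+-suc _ k) (cong (ℕ._+ k) (sym e))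
    ... | inj₂ (a≡q , _) = contradiction a+k<p
            (ℕ.≤⇒≯ (ℕ.≤-trans (ℕ.≤-trans (ℕ.s≤s (ℕ.≤-reflexive (sym a≡q))) (ℕ.s≤s (ℕ.m≤m+n _ k)))
                              (ℕ.≤-reflexive (sym (ℕ.+-suc _ k)))))

    iter-+ : {A : Set} (f : A → A) → ∀ m n x → iter f (m ℕ.+ n) x ≡ iter f n (iter f m x)
    iter-+ f zero    n x = refl
    iter-+ f (suc m) n x = iter-+ f m n (f x)

    reach : ∀ a → iter rot (toℕ a) zero ≡ a
    reach a = Fin.toℕ-injective (iter-rot (toℕ a) zero (Fin.toℕ<n a))

    iter-rot-0 : iter rot p zero ≡ zero
    iter-rot-0 = trans (cong (λ k → iter rot k zero) (ℕ.+-comm 1 q))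
      (trans (iter-+ rot q 1 zero) (last _ (iter-rot q zero ℕ.≤-refl)))
      where
      last : ∀ a → toℕ a ≡ q → rot a ≡ zero
      last a a≡q with rot-cases a
      ... | inj₁ (a<q , _) = contradiction a≡q (ℕ.<⇒≢ a<q)
      ... | inj₂ (_ , e)   = Fin.toℕ-injective e

    rot-order : ∀ a → iter rot p a ≡ a
    rot-order a = begin
      iter rot p a                          ≡⟨ cong (iter rot p) (sym (reach a)) ⟩
      iter rot p (iter rot (toℕ a) zero)    ≡⟨ sym (iter-+ rot (toℕ a) p zero) ⟩
      iter rot (toℕ a ℕ.+ p) zero           ≡⟨ cong (λ k → iter rot k zero) (ℕ.+-comm (toℕ a) p) ⟩
      iter rot (p ℕ.+ toℕ a) zero           ≡⟨ iter-+ rot p (toℕ a) zero ⟩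
      iter rot (toℕ a) (iter rot p zero)    ≡⟨ cong (iter rot (toℕ a)) iter-rot-0 ⟩
      iter rot (toℕ a) zero                 ≡⟨ reach a ⟩
      a                                     ∎
      where open ≡-Reasoning

    rot-injective : ∀ {a b} → rot a ≡ rot b → a ≡ b
    rot-injective {a} {b} e = trans (sym (rot-order a)) (trans (cong (iter rot q) e) (rot-order b))

    rot-invariant⇒const : {A : Set} (c : Fin p → A) → (∀ a → c (rot a) ≡ c a) → ∀ a b → c a ≡ c b
    rot-invariant⇒const c e a b = trans (lem a) (sym (lem b))
      where
      go : ∀ k a → c (iter rot k a) ≡ c a
      go zero    a = refl
      go (suc k) a = trans (go k (rot a)) (e a)
      lem : ∀ a → c a ≡ c zero
      lem a = trans (cong c (sym (reach a))) (go (toℕ a) zero)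

    r : Fin p → ℤ
    r a = + toℕ a

    last? : Fin p → ℤ
    last? a = bit (does (toℕ a ℕ.≟ q))

    -- The borrow in the subtraction b - a of residues. By `less-rot`, rotation changes it by the
    -- coboundary of `last?`.
    less : Fin p → Fin p → ℤ
    less a b = bit (does (toℕ b ℕ.<? toℕ a))

    less-true : ∀ {a b} → toℕ b ℕ.< toℕ a → less a b ≡ 1ℤ
    less-true b<a = cong bit (dec-true (_ ℕ.<? _) b<a)

    less-false : ∀ {a b} → ¬ toℕ b ℕ.< toℕ a → less a b ≡ 0ℤ
    less-false b≮a = cong bit (dec-false (_ ℕ.<? _) b≮a)

    last-true : ∀ {a} → toℕ a ≡ q → last? a ≡ 1ℤ
    last-true e = cong bit (dec-true (_ ℕ.≟ _) e)

    last-false : ∀ {a} → toℕ a ℕ.< q → last? a ≡ 0ℤ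
    last-false l = cong bit (dec-false (_ ℕ.≟ _) (ℕ.<⇒≢ l))

    less-refl : ∀ a → less a a ≡ 0ℤ
    less-refl a = less-false {a} {a} (ℕ.n≮n _)

    r-rot : ∀ a → r (rot a) ≡ r a + 1ℤ + (- + p) * last? a
    r-rot a with rot-cases a
    ... | inj₁ (a<q , e) rewrite last-false {a} a<q | e =
          trans (cong +_ (ℕ.+-comm 1 (toℕ a))) (sym (eq (r a + 1ℤ) (- + p)))
      where
      eq : ∀ x y → x + y * 0ℤ ≡ x
      eq = solve-∀
    ... | inj₂ (a≡q , e) rewrite last-true {a} a≡q | e | a≡q =
          trans (eq (+ q)) (cong (λ b → + q + 1ℤ + b * 1ℤ) (cong (λ b → - b) (cong +_ (ℕ.+-comm q 1))))
      where
      eq : ∀ x → 0ℤ ≡ x + 1ℤ + (- (x + 1ℤ)) * 1ℤ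
      eq = solve-∀

    less-rot : ∀ a b → less (rot a) (rot b) ≡ less a b + last? b + - last? a
    less-rot a b with rot-cases a | rot-cases b
    ... | inj₁ (a<q , e) | inj₁ (b<q , f)
          rewrite last-false {a} a<q | last-false {b} b<q | e | f = sym (trans (ℤ.+-identityʳ _) (ℤ.+-identityʳ _))
    ... | inj₁ (a<q , e) | inj₂ (b≡q , f)
          rewrite last-false {a} a<q | last-true {b} b≡q
                | less-false {a} {b} (λ b<a → ℕ.<-asym a<q (subst (ℕ._< toℕ a) b≡q b<a)) | e | f = refl
    ... | inj₂ (a≡q , e) | inj₁ (b<q , f)
          rewrite last-true {a} a≡q | last-false {b} b<q
                | less-true {a} {b} (subst (toℕ b ℕ.<_) (sym a≡q) b<q) | e = refl
    ... | inj₂ (a≡q , e) | inj₂ (b≡q , f)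
          rewrite last-true {a} a≡q | last-true {b} b≡q
                | less-false {a} {b} (λ b<a → ℕ.<⇒≢ b<a (trans b≡q (sym a≡q))) | e = refl

    -- The residue of b − a modulo p in [0, p).
    diff : Fin p → Fin p → ℤ
    diff a b = r b + - r a + + p * less a b

    diff-rot : ∀ a b → diff (rot a) (rot b) ≡ diff a b
    diff-rot a b rewrite r-rot a | r-rot b | less-rot a b = eq (r a) (r b) (+ p) (last? a) (last? b) (less a b)
      where
      eq : ∀ a b p x y z → b + 1ℤ + (- p) * y + - (a + 1ℤ + (- p) * x) + p * (z + y + - x) ≡ b + - a + p * z
      eq = solve-∀

    rot₂ : Fin p × Fin p → Fin p × Fin p
    rot₂ (a , b) = rot a , rot b

    -- After multiplication by p: `+ p * less a b` is `diff a b` minus `r b - r a`, where `diff` is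
    -- invariant and `r` has the same orbit sum at a and at b.
    orbitSum-less : ∀ a b → orbitSum rot₂ p (λ { (a , b) → less a b }) (a , b) ≡ diff a b
    orbitSum-less a b = ℤ.*-cancelˡ-≡ (+ p) _ _ (begin
      + p * orbitSum rot₂ p less′ (a , b)  ≡⟨ multiple p a b ⟩
      + p * diff a b + orbitSum rot p r a + - orbitSum rot p r b
        ≡⟨ cong (λ x → + p * diff a b + orbitSum rot p r a + - x) (const b a) ⟩
      + p * diff a b + orbitSum rot p r a + - orbitSum rot p r a
        ≡⟨ eq₂ (+ p * diff a b) (orbitSum rot p r a) ⟩
      + p * diff a b ∎)
      where
      open ≡-Reasoning
      less′ : Fin p × Fin p → ℤ
      less′ (a , b) = less a b
      eq₂ : ∀ x y → x + y + - y ≡ x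
      eq₂ = solve-∀
      eq₀ : ∀ p d → p * 0ℤ ≡ 0ℤ * d + 0ℤ + - 0ℤ
      eq₀ = solve-∀
      eq₁ : ∀ p g n u v a b →
        p * g + (n * (b + - a + p * g) + u + - v) ≡ (1ℤ + n) * (b + - a + p * g) + (a + u) + - (b + v)
      eq₁ = solve-∀
      multiple : ∀ n a b →
        + p * orbitSum rot₂ n less′ (a , b) ≡ + n * diff a b + orbitSum rot n r a + - orbitSum rot n r b
      multiple zero    a b = eq₀ (+ p) (diff a b)
      multiple (suc n) a b = begin
        + p * (less a b + orbitSum rot₂ n less′ (rot a , rot b)) ≡⟨ ℤ.*-distribˡ-+ (+ p) (less a b) _ ⟩
        + p * less a b + + p * orbitSum rot₂ n less′ (rot a , rot b)
          ≡⟨ cong (λ x → + p * less a b + x) (trans (multiple n (rot a) (rot b))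
               (cong (λ x → + n * x + orbitSum rot n r (rot a) + - orbitSum rot n r (rot b)) (diff-rot a b))) ⟩
        + p * less a b + (+ n * diff a b + orbitSum rot n r (rot a) + - orbitSum rot n r (rot b))
          ≡⟨ eq₁ (+ p) (less a b) (+ n) (orbitSum rot n r (rot a)) (orbitSum rot n r (rot b)) (r a) (r b) ⟩
        + suc n * diff a b + orbitSum rot (suc n) r a + - orbitSum rot (suc n) r b ∎
      const : ∀ a b → orbitSum rot p r a ≡ orbitSum rot p r b
      const = rot-invariant⇒const (orbitSum rot p r) λ a →
        ℤ+.∙-cancelʳ (r a) _ _ (trans (orbitSum-shift rot p r a)
                                       (cong (λ x → orbitSum rot p r a + r x) (rot-order a)))

  -- Cocycles of the cyclic group

  data Repeats {A : Set} : List A → Set where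
    here  : ∀ {a as}   → Repeats (a ∷ a ∷ as)
    there : ∀ {a as}   → Repeats as → Repeats (a ∷ as)

  -- Prepending a fixed vertex contracts the complex of all lists: it supplies a primitive wherever
  -- c is closed.
  δ-contract : {V : Set} (c : Cochain V) (x : V) (xs : List V) → δ c (x ∷ xs) ≡ 0ℤ → δ (c ∘ (x ∷_)) xs ≡ c xs
  δ-contract c x xs closed =
    trans (eq (c xs) _) (trans (cong (λ y → c xs + -1ℤ * y) closed) (ℤ.+-identityʳ (c xs)))
    where
    eq : ∀ x y → y ≡ x + -1ℤ * (x + -1ℤ * y)
    eq = solve-∀

  module Signed (q : ℕ) where
    open Rotation q

    -- The group cocycles: evenC is a power of the degree 2 (Bockstein) class, oddC is that power
    -- times the degree 1 class; both are homogeneous cochains of the cyclic group.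
    β : Fin p → Fin p → Fin p → ℤ
    β a b c = less b c + - less a c + less a b

    evenC : Cochain (Fin p)
    evenC []               = 0ℤ
    evenC (a ∷ [])         = 1ℤ
    evenC (a ∷ b ∷ [])     = 0ℤ
    evenC (a ∷ b ∷ c ∷ zs) = β a b c * evenC (c ∷ zs)

    -- The subscript counts vertices: cup product on the left with a cochain of degree 0, and for
    -- `_⌣₂_` of degree 1.
    _⌣₁_ : (Fin p → ℤ) → Cochain (Fin p) → Cochain (Fin p)
    (u ⌣₁ c) []       = 0ℤ
    (u ⌣₁ c) (a ∷ zs) = u a * c (a ∷ zs)

    _⌣₂_ : (Fin p → Fin p → ℤ) → Cochain (Fin p) → Cochain (Fin p)
    (g ⌣₂ c) (a ∷ b ∷ zs) = g a b * c (b ∷ zs)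
    (g ⌣₂ c) _            = 0ℤ

    oddC : Cochain (Fin p)
    oddC = diff ⌣₂ evenC

    -- `β` is the coboundary of `less`, so its four-term alternating sum vanishes; the faces that
    -- keep a, b and c are summed by induction.
    evenC-closed : ∀ z → δ evenC z ≡ 0ℤ
    evenC-closed []               = refl
    evenC-closed (a ∷ [])         = refl
    evenC-closed (a ∷ b ∷ [])     = refl
    evenC-closed (a ∷ b ∷ c ∷ []) = refl
    evenC-closed (a ∷ b ∷ c ∷ d ∷ zs) = begin
      β b c d * E + -1ℤ * (β a c d * E + -1ℤ * (β a b d * E
        + -1ℤ * δ (λ ys → β a b c * evenC (c ∷ ys)) (d ∷ zs)))
        ≡⟨ cong (λ x → β b c d * E + -1ℤ * (β a c d * E + -1ℤ * (β a b d * E + -1ℤ * x)))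
             (trans (δ-scale (β a b c) (evenC ∘ (c ∷_)) (d ∷ zs))
                (cong (β a b c *_) (δ-contract evenC c (d ∷ zs) (evenC-closed (c ∷ d ∷ zs))))) ⟩
      β b c d * E + -1ℤ * (β a c d * E + -1ℤ * (β a b d * E + -1ℤ * (β a b c * E)))
        ≡⟨ eq (less a b) (less a c) (less a d) (less b c) (less b d) (less c d) E ⟩
      0ℤ ∎
      where
      open ≡-Reasoning
      E = evenC (d ∷ zs)
      eq : ∀ ab ac ad bc bd cd e →
        (cd + - bd + bc) * e + -1ℤ * ((cd + - ad + ac) * e
          + -1ℤ * ((bd + - ad + ab) * e + -1ℤ * ((bc + - ac + ab) * e))) ≡ 0ℤ
      eq = solve-∀

    evenC-contract : ∀ a b zs → δ (evenC ∘ (a ∷_)) (b ∷ zs) ≡ evenC (b ∷ zs)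
    evenC-contract a b zs = δ-contract evenC a (b ∷ zs) (evenC-closed (a ∷ b ∷ zs))

    -- The primitive is not invariant under rotation, and `less-norm` computes its norm. On a single
    -- vertex `evenC` is 1 and this primitive fails.
    evenC-exact : ∀ a b c zs → δ (less ⌣₂ evenC) (a ∷ b ∷ c ∷ zs) ≡ evenC (a ∷ b ∷ c ∷ zs)
    evenC-exact a b c zs =
      trans (cong (λ x → less b c * E + -1ℤ * (less a c * E + -1ℤ * x))
              (trans (δ-scale (less a b) (evenC ∘ (b ∷_)) (c ∷ zs)) (cong (less a b *_) (evenC-contract b c zs))))
            (eq (less a b) (less a c) (less b c) E)
      where
      E = evenC (c ∷ zs)
      eq : ∀ ab ac bc e → bc * e + -1ℤ * (ac * e + -1ℤ * (ab * e)) ≡ (bc + - ac + ab) * e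
      eq = solve-∀

    -- `diff` is the coboundary of `r` up to p times the borrow.
    oddC-exact-mod : ∀ a b zs → oddC (a ∷ b ∷ zs) ≡ lin (δ (r ⌣₁ evenC)) (+ p) (less ⌣₂ evenC) (a ∷ b ∷ zs)
    oddC-exact-mod a b zs = sym
      (trans (cong (λ x → r b * E + -1ℤ * x + + p * (less a b * E))
               (trans (δ-scale (r a) (evenC ∘ (a ∷_)) (b ∷ zs)) (cong (r a *_) (evenC-contract a b zs))))
             (eq (r a) (r b) (less a b) (+ p) E))
      where
      E = evenC (b ∷ zs)
      eq : ∀ a b g p e → b * e + -1ℤ * (a * e) + p * (g * e) ≡ (b + - a + p * g) * e
      eq = solve-∀

    evenC-rot : ∀ z → evenC (map rot z) ≡ evenC z
    evenC-rot []               = refl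
    evenC-rot (a ∷ [])         = refl
    evenC-rot (a ∷ b ∷ [])     = refl
    evenC-rot (a ∷ b ∷ c ∷ zs) = cong₂ _*_ β-rot (evenC-rot (c ∷ zs))
      where
      eq : ∀ ab ac bc a b c → bc + c + - b + - (ac + c + - a) + (ab + b + - a) ≡ bc + - ac + ab
      eq = solve-∀
      β-rot : β (rot a) (rot b) (rot c) ≡ β a b c
      β-rot rewrite less-rot b c | less-rot a c | less-rot a b =
        eq (less a b) (less a c) (less b c) (last? a) (last? b) (last? c)

    -- Rotation adds 1 to `r` mod p, so ω - 1 takes the mod p primitive of `oddC` to `evenC`.
    r-shift : ∀ z → lin ((r ⌣₁ evenC) ∘ map rot) -1ℤ (r ⌣₁ evenC) z ≡ lin evenC (- + p) (last? ⌣₁ evenC) z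
    r-shift []       = sym (trans (ℤ.+-identityˡ _) (ℤ.*-zeroʳ (- + p)))
    r-shift (a ∷ zs) =
      trans (cong₂ (λ x y → x * y + -1ℤ * (r a * evenC (a ∷ zs))) (r-rot a) (evenC-rot (a ∷ zs)))
            (eq (r a) (- + p) (last? a) (evenC (a ∷ zs)))
      where
      eq : ∀ a p l e → (a + 1ℤ + p * l) * e + -1ℤ * (a * e) ≡ e + p * (l * e)
      eq = solve-∀

    less-norm : ∀ a b zs → orbitSum (map rot) p (less ⌣₂ evenC) (a ∷ b ∷ zs) ≡ oddC (a ∷ b ∷ zs)
    less-norm a b zs = trans (go p a b zs) (cong (_* evenC (b ∷ zs)) (orbitSum-less a b))
      where
      go : ∀ n a b zs → orbitSum (map rot) n (less ⌣₂ evenC) (a ∷ b ∷ zs)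
                        ≡ orbitSum rot₂ n (λ { (a , b) → less a b }) (a , b) * evenC (b ∷ zs)
      go zero    a b zs = sym (ℤ.*-zeroˡ (evenC (b ∷ zs)))
      go (suc n) a b zs = trans
        (cong (λ x → less a b * evenC (b ∷ zs) + x)
          (trans (go n (rot a) (rot b) (map rot zs)) (cong (λ x → S * x) (evenC-rot (b ∷ zs)))))
        (sym (ℤ.*-distribʳ-+ (evenC (b ∷ zs)) (less a b) S))
        where S = orbitSum rot₂ n (λ { (a , b) → less a b }) (rot a , rot b)

    -- On lists of odd length each gap between neighbours belongs to one factor `β`, which vanishes
    -- when the gap is trivial; on even length `evenC` is 0.
    evenC-repeats : ∀ {z} → Repeats z → evenC z ≡ 0ℤ
    evenC-repeats (here {a} {[]})     = refl
    evenC-repeats (here {a} {b ∷ zs}) rewrite less-refl a = eq (less a b) (evenC (b ∷ zs))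
      where
      eq : ∀ x e → (x + - x + 0ℤ) * e ≡ 0ℤ
      eq = solve-∀
    evenC-repeats (there {a} {b ∷ b ∷ zs} here) rewrite less-refl b = eq (less a b) (evenC (b ∷ zs))
      where
      eq : ∀ x e → (0ℤ + - x + x) * e ≡ 0ℤ
      eq = solve-∀
    evenC-repeats (there {a} {b ∷ c ∷ zs} (there i)) =
      trans (cong (β a b c *_) (evenC-repeats i)) (ℤ.*-zeroʳ (β a b c))

    oddC-repeats : ∀ {z} → Repeats z → oddC z ≡ 0ℤ
    oddC-repeats (here {a} {zs}) rewrite less-refl a = eq (r a) (+ p) (evenC (a ∷ zs))
      where
      eq : ∀ x p e → (x + - x + p * 0ℤ) * e ≡ 0ℤ
      eq = solve-∀
    oddC-repeats (there {a} {b ∷ zs} i) =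
      trans (cong (diff a b *_) (evenC-repeats i)) (ℤ.*-zeroʳ (diff a b))

    -- Flags of vectors and the pairing with their fundamental chains

    V : ℕ → Set
    V n = Vec (Fin (suc p)) n

    rot₀ : Fin (suc p) → Fin (suc p)
    rot₀ zero    = zero
    rot₀ (suc a) = suc (rot a)

    rotV : ∀ {n} → V n → V n
    rotV = Vec.map rot₀

    rotV-mono : ∀ {n} {X Y : V n} → X ≼ Y → rotV X ≼ rotV Y
    rotV-mono []       = []
    rotV-mono (inj₁ e ∷ l) = inj₁ (cong rot₀ e) ∷ rotV-mono l
    rotV-mono (inj₂ e ∷ l) = inj₂ (cong rot₀ e) ∷ rotV-mono l

    Nonnull : ∀ {n} → V n → Set
    Nonnull = Any (λ x → ¬ x ≡ zero)

    rotV-nonZero : ∀ {n} {X : V n} → Nonnull X → Nonnull (rotV X)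
    rotV-nonZero (here {x = zero}  x≢0) = contradiction refl x≢0
    rotV-nonZero (here {x = suc a} x≢0) = here λ ()
    rotV-nonZero (there i)              = there (rotV-nonZero i)

    Flag : ∀ {n} → ℕ → List (V n) → Set
    Flag m z = length z ≡ m × All Nonnull z × Linked _≼_ z

    rotF : ∀ {n} → List (V n) → List (V n)
    rotF = map rotV

    rotF-flag : ∀ {n m} {z : List (V n)} → Flag m z → Flag m (rotF z)
    rotF-flag {z = z} (l , nz , lk) =
      trans (List.length-map rotV z) l , All.map⁺ (All.map rotV-nonZero nz) , Linked.map⁺ (Linked.map rotV-mono lk)

    -- The zigzag `i₀ X` ≼ `j₀ X` ≽ `apex` contracts the copy of `V n` inside `V (suc n)`.
    i₀ j₀ : ∀ {n} → V n → V (suc n)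
    i₀ X = zero ∷ X
    j₀ X = suc zero ∷ X

    apex : ∀ {n} → V (suc n)
    apex {n} = suc zero ∷ Vec.replicate n zero

    0≼ : ∀ {n} (X : V n) → Vec.replicate n zero ≼ X
    0≼ []      = []
    0≼ (x ∷ X) = inj₁ refl ∷ 0≼ X

    top-flag : ∀ {n m} {z : List (V n)} → Flag m z → Flag (suc m) (apex ∷ map j₀ z)
    top-flag {z = z} (l , nz , lk) =
      cong suc (trans (List.length-map j₀ z) l) ,
      here (λ ()) ∷ All.map⁺ (All.map (λ _ → here λ ()) nz) ,
      go z lk
      where
      go : ∀ z → Linked _≼_ z → Linked _≼_ (apex ∷ map j₀ z)
      go []      _  = [-]
      go (X ∷ z) lk = (inj₂ refl ∷ 0≼ X) ∷ Linked.map⁺ (Linked.map (inj₂ refl ∷_) lk)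

    prism-flag : ∀ {n m} {z : List (V n)} {y} → Prism i₀ j₀ z y → Flag m z → Flag (suc m) y
    prism-flag (here {X} {z}) (l , nz@(nX ∷ _) , lk) =
      cong suc (trans (List.length-map j₀ (X ∷ z)) l) ,
      there nX ∷ All.map⁺ (All.map there nz) ,
      (inj₁ refl ∷ ≼-refl) ∷ Linked.map⁺ (Linked.map (inj₂ refl ∷_) lk)
    prism-flag (there P@here) (refl , nX ∷ nz , X≼Y ∷ lk) with prism-flag P (refl , nz , lk)
    ... | l , nz′ , lk′ = cong suc l , there nX ∷ nz′ , (inj₂ refl ∷ X≼Y) ∷ lk′
    prism-flag (there P@(there _)) (refl , nX ∷ nz , X≼Y ∷ lk) with prism-flag P (refl , nz , lk)
    ... | l , nz′ , lk′ = cong suc l , there nX ∷ nz′ , (inj₂ refl ∷ X≼Y) ∷ lk′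

    -- Multiplication by 1, ω − 1, N, ω − 1, N, … where ω is the rotation and N its norm element.
    T : ∀ {n} → ℕ → Cochain (V n) → Cochain (V n)
    T 0                   c = c
    T 1                   c = lin (c ∘ rotF) -1ℤ c
    T 2                   c = orbitSum rotF p c
    T (suc (suc (suc n))) c = T (suc n) c

    -- Pairing with a fundamental (n − 1)-chain of flags; its boundary is T of the preceding chain.
    ⟨_⟩ : ∀ n → Cochain (V n) → ℤ
    ⟨ zero  ⟩ c = c []
    ⟨ suc n ⟩ c = ⟨ n ⟩ (T n (cone i₀ j₀ apex c))

    T-cong : ∀ {n m} k {c d : Cochain (V n)} → (∀ {z} → Flag m z → c z ≡ d z) →
             ∀ {z} → Flag m z → T k c z ≡ T k d z
    T-cong 0 e f = e f
    T-cong 1 e f = cong₂ (λ a b → a + -1ℤ * b) (e (rotF-flag f)) (e f)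
    T-cong {m = m} 2 {c} {d} e f = go p f
      where
      go : ∀ k {z} → Flag m z → orbitSum rotF k c z ≡ orbitSum rotF k d z
      go zero    f = refl
      go (suc k) f = cong₂ _+_ (e f) (go k (rotF-flag f))
    T-cong (suc (suc (suc n))) e f = T-cong (suc n) e f

    T-lin : ∀ {n} m (c : Cochain (V n)) k d z → T m (lin c k d) z ≡ lin (T m c) k (T m d) z
    T-lin 0 c k d z = refl
    T-lin 1 c k d z = eq (c (rotF z)) (c z) k (d (rotF z)) (d z)
      where
      eq : ∀ a b k c d → a + k * c + -1ℤ * (b + k * d) ≡ a + -1ℤ * b + k * (c + -1ℤ * d)
      eq = solve-∀
    T-lin 2 c k d z = orbitSum-lin rotF p c k d z
    T-lin (suc (suc (suc n))) c k d z = T-lin (suc n) c k d z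

    T-δ : ∀ {n} m (c : Cochain (V n)) z → T m (δ c) z ≡ δ (T m c) z
    T-δ 0 c z = refl
    T-δ 1 c z = sym (trans (δ-lin (c ∘ rotF) -1ℤ c z) (cong (λ a → a + -1ℤ * δ c z) (δ-map rotV c z)))
    T-δ 2 c z = go p z
      where
      δ-0 : ∀ {V : Set} (z : List V) → δ (λ _ → 0ℤ) z ≡ 0ℤ
      δ-0 []      = refl
      δ-0 (x ∷ z) = trans (ℤ.+-identityˡ _) (trans (cong (-1ℤ *_) (δ-0 z)) (ℤ.*-zeroʳ -1ℤ))
      lin1 : ∀ x y → x + y ≡ x + 1ℤ * y
      lin1 = solve-∀
      go : ∀ k z → orbitSum rotF k (δ c) z ≡ δ (orbitSum rotF k c) z
      go zero    z = sym (δ-0 z)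
      go (suc k) z = begin
        δ c z + orbitSum rotF k (δ c) (rotF z)
          ≡⟨ cong (λ x → δ c z + x) (trans (go k (rotF z)) (sym (δ-map rotV _ z))) ⟩
        δ c z + δ (orbitSum rotF k c ∘ rotF) z             ≡⟨ lin1 (δ c z) (δ (orbitSum rotF k c ∘ rotF) z) ⟩
        δ c z + 1ℤ * δ (orbitSum rotF k c ∘ rotF) z        ≡⟨ sym (δ-lin c 1ℤ (orbitSum rotF k c ∘ rotF) z) ⟩
        δ (lin c 1ℤ (orbitSum rotF k c ∘ rotF)) z
          ≡⟨ δ-cong (λ y → sym (lin1 (c y) (orbitSum rotF k c (rotF y)))) z ⟩
        δ (orbitSum rotF (suc k) c) z                      ∎
        where open ≡-Reasoning
    T-δ (suc (suc (suc n))) c z = T-δ (suc n) c z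

    rotV-order : ∀ {n} (X : V n) → iter rotV p X ≡ X
    rotV-order X = go X
      where
      order₀ : ∀ k x → iter rot₀ k (suc x) ≡ suc (iter rot k x)
      order₀ zero    x = refl
      order₀ (suc k) x = order₀ k (rot x)
      order₁ : ∀ k → iter rot₀ k zero ≡ zero
      order₁ zero    = refl
      order₁ (suc k) = order₁ k
      go : ∀ {n} (X : V n) → iter rotV p X ≡ X
      go []      = emp p
        where
        emp : ∀ k → iter (rotV {0}) k [] ≡ []
        emp zero    = refl
        emp (suc k) = emp k
      go (x ∷ X) = trans (cs p x X) (cong₂ _∷_ (hd x) (go X))
        where
        cs : ∀ {n} k x (X : V n) → iter rotV k (x ∷ X) ≡ iter rot₀ k x ∷ iter rotV k X
        cs zero    x X = refl
        cs (suc k) x X = cs k (rot₀ x) (rotV X)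
        hd : ∀ x → iter rot₀ p x ≡ x
        hd zero    = order₁ p
        hd (suc x) = trans (order₀ p x) (cong suc (rot-order x))

    rotF-order : ∀ {n} (z : List (V n)) → iter rotF p z ≡ z
    rotF-order {n} []      = emp p
      where
      emp : ∀ k → iter (rotF {n}) k [] ≡ []
      emp zero    = refl
      emp (suc k) = emp k
    rotF-order (X ∷ z) = trans (cs p X z) (cong₂ _∷_ (rotV-order X) (rotF-order z))
      where
      cs : ∀ {n} k (X : V n) z → iter rotF k (X ∷ z) ≡ iter rotV k X ∷ iter rotF k z
      cs zero    X z = refl
      cs (suc k) X z = cs k (rotV X) (rotF z)

    -- (ω - 1)N = N(ω - 1) = 0, because ω has order p.
    T-T : ∀ {n} m (c : Cochain (V n)) z → T (suc m) (T (suc (suc m)) c) z ≡ 0ℤ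
    T-T 0 c z = sub0 (orbitSum rotF p c (rotF z)) (orbitSum rotF p c z)
      (ℤ+.∙-cancelʳ (c z) _ _ (trans (orbitSum-shift rotF p c z)
        (cong (λ y → orbitSum rotF p c z + c y) (rotF-order z))))
      where
      eq : ∀ a → a + -1ℤ * a ≡ 0ℤ
      eq = solve-∀
      sub0 : ∀ a b → a ≡ b → a + -1ℤ * b ≡ 0ℤ
      sub0 a _ refl = eq a
    T-T 1 c z = trans (orbitSum-lin rotF p (c ∘ rotF) -1ℤ c z)
      (trans (cong (λ x → x + -1ℤ * orbitSum rotF p c z) (orbitSum-∘ rotF p c z)) (T-T 0 c z))
    T-T (suc (suc m)) c z = T-T m c z

    -- The chain behind `⟨ n ⟩` is supported on flags of n nonnull vectors. This is what lets
    -- equivariance be used inside a pairing.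
    ⟨⟩-cong : ∀ n {c d} → (∀ {z} → Flag n z → c z ≡ d z) → ⟨ n ⟩ c ≡ ⟨ n ⟩ d
    ⟨⟩-cong zero    e = e (refl , [] , [])
    ⟨⟩-cong (suc n) e = ⟨⟩-cong n (T-cong n λ {z} f →
      cong₂ (λ a b → a + -1ℤ * b) (e (top-flag f)) (prism-cong i₀ j₀ z λ P → e (prism-flag P f)))

    ⟨⟩-cong′ : ∀ n {c d} → (∀ z → c z ≡ d z) → ⟨ n ⟩ c ≡ ⟨ n ⟩ d
    ⟨⟩-cong′ n e = ⟨⟩-cong n λ {z} _ → e z

    ⟨⟩-lin : ∀ n c k d → ⟨ n ⟩ (lin c k d) ≡ ⟨ n ⟩ c + k * ⟨ n ⟩ d
    ⟨⟩-lin zero    c k d = refl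
    ⟨⟩-lin (suc n) c k d =
      trans (⟨⟩-cong n λ {z} f → trans (T-cong n (λ {z} _ → cone-lin i₀ j₀ apex c k d z) f)
                                       (T-lin n (cone i₀ j₀ apex c) k (cone i₀ j₀ apex d) z))
            (⟨⟩-lin n _ k _)

    ⟨⟩-0 : ∀ n → ⟨ n ⟩ (λ _ → 0ℤ) ≡ 0ℤ
    ⟨⟩-0 n = trans (⟨⟩-lin n (λ _ → 0ℤ) -1ℤ (λ _ → 0ℤ)) (eq (⟨ n ⟩ (λ _ → 0ℤ)))
      where
      eq : ∀ a → a + -1ℤ * a ≡ 0ℤ
      eq = solve-∀

    -- Mutual induction: coning returns the preceding chain times `T` provided that this product is
    -- a cycle, which is `⟨⟩-Tδ`; there the boundary formula one step lower produces two consecutive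
    -- multipliers, whose product is 0.
    ⟨⟩-δ  : ∀ n c → ⟨ suc n ⟩ (δ c) ≡ ⟨ n ⟩ (T n (c ∘ map i₀))
    ⟨⟩-Tδ : ∀ n c → ⟨ n ⟩ (T n (δ c)) ≡ 0ℤ
    ⟨⟩-δ n c = begin
      ⟨ n ⟩ (T n (cone i₀ j₀ apex (δ c)))
        ≡⟨ ⟨⟩-cong n (λ {z} f → trans (T-cong n (λ {z} _ → cone-δ i₀ j₀ apex c z) f)
                                      (T-lin n (c ∘ map i₀) -1ℤ (δ (cone i₀ j₀ apex c)) z)) ⟩
      ⟨ n ⟩ (lin (T n (c ∘ map i₀)) -1ℤ (T n (δ (cone i₀ j₀ apex c)))) ≡⟨ ⟨⟩-lin n _ -1ℤ _ ⟩
      ⟨ n ⟩ (T n (c ∘ map i₀)) + -1ℤ * ⟨ n ⟩ (T n (δ (cone i₀ j₀ apex c)))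
        ≡⟨ cong (λ x → ⟨ n ⟩ (T n (c ∘ map i₀)) + -1ℤ * x) (⟨⟩-Tδ n _) ⟩
      ⟨ n ⟩ (T n (c ∘ map i₀)) + 0ℤ ≡⟨ ℤ.+-identityʳ _ ⟩
      ⟨ n ⟩ (T n (c ∘ map i₀)) ∎
      where open ≡-Reasoning
    ⟨⟩-Tδ zero c = refl
    -- In dimension 0 the augmentation kills ω - 1.
    ⟨⟩-Tδ (suc zero) c = trans (⟨⟩-cong′ 1 (T-δ 1 c)) (trans (⟨⟩-δ 0 (T 1 c)) (eq (c [])))
      where
      eq : ∀ a → a + -1ℤ * a ≡ 0ℤ
      eq = solve-∀
    ⟨⟩-Tδ (suc (suc n)) c = begin
      ⟨ suc (suc n) ⟩ (T (suc (suc n)) (δ c))                        ≡⟨ ⟨⟩-cong′ (suc (suc n)) (T-δ (suc (suc n)) c) ⟩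
      ⟨ suc (suc n) ⟩ (δ (T (suc (suc n)) c))                        ≡⟨ ⟨⟩-δ (suc n) (T (suc (suc n)) c) ⟩
      ⟨ suc n ⟩ (T (suc n) (T (suc (suc n)) c ∘ map i₀))
        ≡⟨ ⟨⟩-cong (suc n) (T-cong (suc n) λ {z} _ → T-i₀ (suc (suc n)) c z) ⟩
      ⟨ suc n ⟩ (T (suc n) (T (suc (suc n)) (c ∘ map i₀)))           ≡⟨ ⟨⟩-cong′ (suc n) (T-T n (c ∘ map i₀)) ⟩
      ⟨ suc n ⟩ (λ _ → 0ℤ)                                           ≡⟨ ⟨⟩-0 (suc n) ⟩
      0ℤ                                                             ∎
      where
      open ≡-Reasoning
      comm : ∀ {n} (z : List (V n)) → map i₀ (rotF z) ≡ rotF (map i₀ z)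
      comm []      = refl
      comm (X ∷ z) = cong (i₀ (rotV X) ∷_) (comm z)
      T-i₀ : ∀ {n} m (c : Cochain (V (suc n))) z → T m c (map i₀ z) ≡ T m (c ∘ map i₀) z
      T-i₀ 0 c z = refl
      T-i₀ 1 c z = cong (λ y → c y + -1ℤ * c (map i₀ z)) (sym (comm z))
      T-i₀ 2 c z = sym (orbitSum-map rotF rotF (map i₀) (λ _ → List _) id (λ {x} _ → comm x) p c {z} z)
      T-i₀ (suc (suc (suc n))) c z = T-i₀ (suc n) c z

    T-odd : ∀ {n} l (c : Cochain (V n)) z → T (suc (l ℕ.* 2)) c z ≡ lin (c ∘ rotF) -1ℤ c z
    T-odd zero    c z = refl
    T-odd (suc l) c z = T-odd l c z

    T-even : ∀ {n} l (c : Cochain (V n)) z → T (suc (suc (l ℕ.* 2))) c z ≡ orbitSum rotF p c z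
    T-even zero    c z = refl
    T-even (suc l) c z = T-even l c z

    -- Nontrivial pairings and the Tucker lemma

    Equivariant : ∀ {n} → (V n → Fin p) → Set
    Equivariant s = ∀ {X} → Nonnull X → s (rotV X) ≡ rot (s X)

    map-equivariant : ∀ {n m} {s : V n → Fin p} → Equivariant s →
                      ∀ {z} → Flag m z → map s (rotF z) ≡ map rot (map s z)
    map-equivariant {s = s} es (_ , nz , _) = go nz
      where
      go : ∀ {z} → All Nonnull z → map s (rotF z) ≡ map rot (map s z)
      go []         = refl
      go (nX ∷ nz) = cong₂ _∷_ (es nX) (go nz)

    ≡1 : ℤ → Set
    ≡1 x = ∃ λ k → x ≡ 1ℤ + + p * k

    ⟨⟩-δ-map : ∀ n (c : Cochain (Fin p)) (s : V (suc n) → Fin p) →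
               ⟨ suc n ⟩ (δ c ∘ map s) ≡ ⟨ n ⟩ (T n (c ∘ map (s ∘ i₀)))
    ⟨⟩-δ-map n c s =
      trans (⟨⟩-cong′ (suc n) λ z → sym (δ-map s c z))
      (trans (⟨⟩-δ n (c ∘ map s)) (⟨⟩-cong n (T-cong n λ {z} _ → cong c (sym (List.map-∘ z)))))

    -- Odd and even refer to the number of vertices. Each pairing descends to the previous one
    -- through a primitive: the norm of the primitive of `evenC` is `oddC`, and ω - 1 takes that of
    -- `oddC` to `evenC` mod p. The descent ends at a single vertex, with value 1.
    odd-pairing  : ∀ l (s : V (suc (l ℕ.* 2)) → Fin p) → Equivariant s → ≡1 (⟨ suc (l ℕ.* 2) ⟩ (evenC ∘ map s))
    even-pairing : ∀ l (s : V (suc (suc (l ℕ.* 2))) → Fin p) → Equivariant s → ≡1 (⟨ suc (suc (l ℕ.* 2)) ⟩ (oddC ∘ map s))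

    odd-pairing zero    s es = 0ℤ , cong (λ x → 1ℤ + x) (sym (ℤ.*-zeroʳ (+ p)))
    odd-pairing (suc l) s es with even-pairing l (s ∘ i₀) (λ nX → es (there nX))
    ... | k , e = k , (begin
      ⟨ suc n ⟩ (evenC ∘ map s)                                   ≡⟨ ⟨⟩-cong (suc n) (λ {z} f → sym (exact z f)) ⟩
      ⟨ suc n ⟩ (δ (less ⌣₂ evenC) ∘ map s)                       ≡⟨ ⟨⟩-δ-map n (less ⌣₂ evenC) s ⟩
      ⟨ n ⟩ (T n ((less ⌣₂ evenC) ∘ map (s ∘ i₀)))                ≡⟨ ⟨⟩-cong n (λ {z} f → norm z f) ⟩
      ⟨ n ⟩ (oddC ∘ map (s ∘ i₀))                                 ≡⟨ e ⟩
      1ℤ + + p * k                                                ∎)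
      where
      open ≡-Reasoning
      n = suc (suc (l ℕ.* 2))
      exact : ∀ z → Flag (suc n) z → δ (less ⌣₂ evenC) (map s z) ≡ evenC (map s z)
      exact (X ∷ Y ∷ Z ∷ z) f = evenC-exact (s X) (s Y) (s Z) (map s z)
      norm : ∀ z → Flag n z → T n ((less ⌣₂ evenC) ∘ map (s ∘ i₀)) z ≡ oddC (map (s ∘ i₀) z)
      norm z@(X ∷ Y ∷ z′) f = begin
        T n ((less ⌣₂ evenC) ∘ map (s ∘ i₀)) z               ≡⟨ T-even l _ z ⟩
        orbitSum rotF p ((less ⌣₂ evenC) ∘ map (s ∘ i₀)) z
          ≡⟨ orbitSum-map rotF (map rot) (map (s ∘ i₀)) (Flag n) rotF-flag
               (map-equivariant {s = s ∘ i₀} (λ nX → es (there nX))) p (less ⌣₂ evenC) f ⟩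
        orbitSum (map rot) p (less ⌣₂ evenC) (map (s ∘ i₀) z)
          ≡⟨ less-norm (s (i₀ X)) (s (i₀ Y)) (map (s ∘ i₀) z′) ⟩
        oddC (map (s ∘ i₀) z)                                ∎

    even-pairing l s es with odd-pairing l (s ∘ i₀) (λ nX → es (there nX))
    -- Here g and h collect the multiples of p from `oddC-exact-mod` and `r-shift`.
    ... | k , e = k + - h + g , (begin
      ⟨ suc n ⟩ (oddC ∘ map s)
        ≡⟨ ⟨⟩-cong (suc n) (λ {z} f → exact z f) ⟩
      ⟨ suc n ⟩ (lin (δ (r ⌣₁ evenC) ∘ map s) (+ p) ((less ⌣₂ evenC) ∘ map s))
        ≡⟨ ⟨⟩-lin (suc n) (δ (r ⌣₁ evenC) ∘ map s) (+ p) _ ⟩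
      ⟨ suc n ⟩ (δ (r ⌣₁ evenC) ∘ map s) + + p * g
        ≡⟨ cong (λ x → x + + p * g) (⟨⟩-δ-map n (r ⌣₁ evenC) s) ⟩
      ⟨ n ⟩ (T n ((r ⌣₁ evenC) ∘ map (s ∘ i₀))) + + p * g
        ≡⟨ cong (λ x → x + + p * g) (⟨⟩-cong n (λ {z} f → shift z f)) ⟩
      ⟨ n ⟩ (lin (evenC ∘ map (s ∘ i₀)) (- + p) ((last? ⌣₁ evenC) ∘ map (s ∘ i₀))) + + p * g
        ≡⟨ cong (λ x → x + + p * g) (⟨⟩-lin n (evenC ∘ map (s ∘ i₀)) (- + p) _) ⟩
      ⟨ n ⟩ (evenC ∘ map (s ∘ i₀)) + (- + p) * h + + p * g
        ≡⟨ cong (λ x → x + (- + p) * h + + p * g) e ⟩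
      1ℤ + + p * k + (- + p) * h + + p * g
        ≡⟨ eq (+ p) k h g ⟩
      1ℤ + + p * (k + - h + g)                                                       ∎)
      where
      open ≡-Reasoning
      n = suc (l ℕ.* 2)
      g = ⟨ suc n ⟩ ((less ⌣₂ evenC) ∘ map s)
      h = ⟨ n ⟩ ((last? ⌣₁ evenC) ∘ map (s ∘ i₀))
      eq : ∀ p k h g → 1ℤ + p * k + (- p) * h + p * g ≡ 1ℤ + p * (k + - h + g)
      eq = solve-∀
      exact : ∀ z → Flag (suc n) z → oddC (map s z) ≡ lin (δ (r ⌣₁ evenC)) (+ p) (less ⌣₂ evenC) (map s z)
      exact (X ∷ Y ∷ z) f = oddC-exact-mod (s X) (s Y) (map s z)
      shift : ∀ z → Flag n z → T n ((r ⌣₁ evenC) ∘ map (s ∘ i₀)) z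
                               ≡ lin evenC (- + p) (last? ⌣₁ evenC) (map (s ∘ i₀) z)
      shift z f = trans (T-odd l _ z)
        (trans (cong (λ y → (r ⌣₁ evenC) y + -1ℤ * (r ⌣₁ evenC) (map (s ∘ i₀) z))
                     (map-equivariant {s = s ∘ i₀} (λ nX → es (there nX)) f))
               (r-shift (map (s ∘ i₀) z)))

    repeats-pairing : ∀ n (s : V (suc n) → Fin p) → Equivariant s → ¬ q ≡ 0 →
                      ¬ (∀ {z} → Flag (suc n) z → Repeats (map s z))
    repeats-pairing n s es q≢0 rep = cases (parity n)
      where
      parity : ∀ n → ∃ λ l → n ≡ l ℕ.* 2 ⊎ n ≡ suc (l ℕ.* 2)
      parity 0 = 0 , inj₁ refl
      parity 1 = 0 , inj₂ refl
      parity (suc (suc n)) with parity n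
      ... | l , inj₁ e = suc l , inj₁ (cong (2 ℕ.+_) e)
      ... | l , inj₂ e = suc l , inj₂ (cong (2 ℕ.+_) e)
      0≢1 : ∀ {x} → ≡1 x → ¬ x ≡ 0ℤ
      0≢1 (k , e) refl = q≢0 (ℕ.suc-injective (∣1⇒≡1 (ℤ∣.∣⇒∣ᵤ (ℤ∣.divides (- k) (eq k (+ p) (sym e))))))
        where
        eq₁ : ∀ k p → 1ℤ ≡ (1ℤ + p * k) + (- k) * p
        eq₁ = solve-∀
        eq : ∀ k p → 1ℤ + p * k ≡ 0ℤ → 1ℤ ≡ (- k) * p
        eq k p e = trans (eq₁ k p) (trans (cong (λ x → x + (- k) * p) e) (ℤ.+-identityˡ _))
      cases : ¬ ∃ λ l → n ≡ l ℕ.* 2 ⊎ n ≡ suc (l ℕ.* 2)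
      cases (l , inj₁ refl) = 0≢1 (odd-pairing l s es)
        (trans (⟨⟩-cong (suc n) λ f → evenC-repeats (rep f)) (⟨⟩-0 (suc n)))
      cases (l , inj₂ refl) = 0≢1 (even-pairing l s es)
        (trans (⟨⟩-cong (suc n) λ f → oddC-repeats (rep f)) (⟨⟩-0 (suc n)))

    tucker : ∀ n (s : V (suc n) → Fin p) (ρ : V (suc n) → ℕ) → ¬ q ≡ 0 → Equivariant s →
             (∀ {X} → Nonnull X → 1 ℕ.≤ ρ X × ρ X ℕ.≤ n) →
             (∀ {X Y} → Nonnull X → Nonnull Y → X ≼ Y → ρ X ℕ.≤ ρ Y × (ρ X ≡ ρ Y → s X ≡ s Y)) → ⊥
    tucker n s ρ q≢0 es range mono = repeats-pairing n s es q≢0 rep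
      where
      -- Each step that does not repeat the sign raises ρ, so at most n - ρ X steps can avoid a
      -- repetition.
      climb : ∀ X z → All Nonnull (X ∷ z) → Linked _≼_ (X ∷ z) →
              Repeats (map s (X ∷ z)) ⊎ ρ X ℕ.+ length z ℕ.≤ n
      climb X []      (nX ∷ []) _ = inj₂ (subst (ℕ._≤ n) (sym (ℕ.+-identityʳ _)) (proj₂ (range nX)))
      climb X (Y ∷ z) (nX ∷ nz@(nY ∷ _)) (X≼Y ∷ lk) with mono nX nY X≼Y
      ... | ρX≤ρY , same with ℕ.m≤n⇒m<n∨m≡n ρX≤ρY
      ... | inj₂ e rewrite same e = inj₁ here
      ... | inj₁ ρX<ρY with climb Y z nz lk
      ... | inj₁ rp = inj₁ (there rp)
      ... | inj₂ ρY+z≤n = inj₂ (ℕ.≤-trans (ℕ.≤-reflexive (ℕ.+-suc (ρ X) (length z)))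
                                            (ℕ.≤-trans (ℕ.+-monoˡ-≤ (length z) ρX<ρY) ρY+z≤n))
      rep : ∀ {z} → Flag (suc n) z → Repeats (map s z)
      rep {X ∷ z} (l , nz@(nX ∷ _) , lk) with climb X z nz lk
      ... | inj₁ rp = rp
      ... | inj₂ ρX+z≤n = contradiction
        (ℕ.≤-trans (ℕ.+-mono-≤ (proj₁ (range nX)) (ℕ.≤-reflexive (sym (ℕ.suc-injective l)))) ρX+z≤n)
        (ℕ.n≮n n)

open Cohomology
open import Data.Nat using (_+_; _*_)
open import Data.Nat.Properties
open import Data.Nat.Tactic.RingSolver using (solve-∀)

-- A congruence with multiples of n on both sides avoids subtraction in ℕ.
%-step : ∀ {x y} n .{{_ : NonZero n}} a b → x + a * n ≡ 1 + y + b * n → x % n ≡ suc (y % n) % n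
%-step {x} {y} n a b e = begin
  x % n                      ≡⟨ sym ([m+kn]%n≡m%n x a n) ⟩
  (x + a * n) % n            ≡⟨ cong (_% n) e ⟩
  (1 + y + b * n) % n        ≡⟨ [m+kn]%n≡m%n (1 + y) b n ⟩
  (1 + y) % n                ≡⟨ %-distribˡ-+ 1 y n ⟩
  (1 % n + y % n) % n        ≡⟨ cong (λ z → (1 % n + z) % n) (sym (m%n%n≡m%n y n)) ⟩
  (1 % n + y % n % n) % n    ≡⟨ sym (%-distribˡ-+ 1 (y % n) n) ⟩
  suc (y % n) % n            ∎
  where open ≡-Reasoning

-- Equivariant choice from a set of residues

module Select (q : ℕ) (p-prime : Prime (suc q)) where
  open Rotation q

  sum-rot : (f : Fin p → ℕ) → sum (f ∘ rot) ≡ sum f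
  sum-rot f = sym (sum-permute f (permutation rot (iter rot q)
    (λ a → trans (sym (iter-+ rot q 1 a)) (trans (cong (λ k → iter rot k a) (+-comm q 1)) (rot-order a)))
    rot-order))

  inverse : ∀ k → 0 < k → k < p → ∃ λ u → ∃ λ a → ∃ λ b → u * k + a * p ≡ 1 + b * p
  inverse (suc k) _ k<p with coprime-Bézout (prime⇒coprime p-prime k<p)
  ... | Bézout.-+ x y e = y , 0 , x , trans (+-identityʳ _) (sym e)
  -- Here 1 + y k = x p, so -y inverts k; q stands for -1.
  ... | Bézout.+- x y e = q * y , 1 , q * x , (begin
    q * y * suc k + 1 * suc q   ≡⟨ eq₁ q y (suc k) ⟩
    q * (1 + y * suc k) + 1     ≡⟨ cong (λ z → q * z + 1) e ⟩
    q * (x * suc q) + 1         ≡⟨ eq₂ q x ⟩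
    1 + q * x * suc q           ∎)
    where
    open ≡-Reasoning
    eq₁ : ∀ q y k → q * y * k + 1 * suc q ≡ q * (1 + y * k) + 1
    eq₁ = solve-∀
    eq₂ : ∀ q x → q * (x * suc q) + 1 ≡ 1 + q * x * suc q
    eq₂ = solve-∀

  -- The default 0 makes `mean` total; `pick` takes a mean only for sizes strictly between 0 and p.
  inv : ℕ → ℕ
  inv k with 0 <? k | k <? p
  ... | yes 0<k | yes k<p = proj₁ (inverse k 0<k k<p)
  ... | _       | _       = 0

  inv-inverse : ∀ k → 0 < k → k < p → ∃ λ a → ∃ λ b → inv k * k + a * p ≡ 1 + b * p
  inv-inverse k 0<k k<p with 0 <? k | k <? p
  ... | yes 0<k′ | yes k<p′ = proj₂ (inverse k 0<k′ k<p′)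
  ... | no  0≮k  | _        = contradiction 0<k 0≮k
  ... | yes _    | no k≮p   = contradiction k<p k≮p

  residue : ℕ → Fin p
  residue x = fromℕ< (m%n<n x p)

  residue-step : ∀ {x y} a b → x + a * p ≡ 1 + y + b * p → residue x ≡ rot (residue y)
  residue-step {x} {y} a b e = Fin.toℕ-injective
    (trans (Fin.toℕ-fromℕ< _)
    (trans (%-step p a b e)
    (trans (cong (λ z → suc z % p) (sym (Fin.toℕ-fromℕ< (m%n<n y p))))
           (sym (Fin.toℕ-fromℕ< _)))))

  -- Since u s ≡ 1, adding s to the moment adds 1 to u times the moment.
  scale-step : ∀ {m m′} s u → (∃ λ a → ∃ λ b → u * s + a * p ≡ 1 + b * p) → (∃ λ k → m′ + k * p ≡ m + s) →
               residue (u * m′) ≡ rot (residue (u * m))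
  scale-step {m} {m′} s u (a , b , inv-eq) (k , mom-eq) = residue-step (u * k + a) b
    (trans (eq₁ u m′ k a p)
    (trans (cong (λ z → u * z + a * p) mom-eq)
    (trans (eq₂ u m s a p)
    (trans (cong (u * m +_) inv-eq) (eq₃ (u * m) (b * p))))))
    where
    eq₁ : ∀ u m k a p → u * m + (u * k + a) * p ≡ u * (m + k * p) + a * p
    eq₁ = solve-∀
    eq₂ : ∀ u m s a p → u * (m + s) + a * p ≡ u * m + (u * s + a * p)
    eq₂ = solve-∀
    eq₃ : ∀ x b → x + (1 + b) ≡ 1 + x + b
    eq₃ = solve-∀

  moment : (Fin p → Bool) → ℕ
  moment S = sum (λ a → indicator (S a) * toℕ a)

  -- The average of the elements of S modulo p: this is where primality enters.
  mean : (Fin p → Bool) → Fin p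
  mean S = residue (inv (size S) * moment S)

  toℕ-rot-mod : ∀ a → ∃ λ k → toℕ (rot a) + k * p ≡ suc (toℕ a)
  toℕ-rot-mod a with rot-cases a
  ... | inj₁ (_ , e)   = 0 , trans (+-identityʳ _) e
  ... | inj₂ (a≡q , e) = 1 , trans (cong (_+ (p + 0)) e) (trans (+-identityʳ p) (cong suc (sym a≡q)))

  _rotates_ : (Fin p → Bool) → (Fin p → Bool) → Set
  S′ rotates S = ∀ a → S′ (rot a) ≡ S a

  size-rot : ∀ {S S′} → S′ rotates S → size S′ ≡ size S
  size-rot {S} {S′} e = trans (sym (sum-rot (indicator ∘ S′))) (sum-cong-≗ (λ a → cong indicator (e a)))

  -- Every element of S grows by 1, except that q falls back to 0; the multiple of p accounts for
  -- that.
  moment-rot : ∀ {S S′} → S′ rotates S → ∃ λ k → moment S′ + k * p ≡ moment S + size S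
  moment-rot {S} {S′} e = sum weight , (begin
    moment S′ + sum weight * p
      ≡⟨ cong₂ (λ x y → x + y) (trans (sym (sum-rot (λ a → indicator (S′ a) * toℕ a)))
                                     (sum-cong-≗ (λ a → cong (λ b → indicator b * toℕ (rot a)) (e a))))
                              (trans (*-comm (sum weight) p) (*-distribˡ-sum p weight)) ⟩
    sum (λ a → indicator (S a) * toℕ (rot a)) + sum (λ a → p * weight a)
      ≡⟨ sym (∑-distrib-+ (λ a → indicator (S a) * toℕ (rot a)) (λ a → p * weight a)) ⟩
    sum (λ a → indicator (S a) * toℕ (rot a) + p * weight a)
      ≡⟨ sum-cong-≗ (λ a → trans (eq₁ (indicator (S a)) (toℕ (rot a)) p (carry a))
                             (trans (cong (indicator (S a) *_) (proj₂ (toℕ-rot-mod a))) (eq₂ (indicator (S a)) (toℕ a)))) ⟩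
    sum (λ a → indicator (S a) * toℕ a + indicator (S a))
      ≡⟨ ∑-distrib-+ (λ a → indicator (S a) * toℕ a) (indicator ∘ S) ⟩
    moment S + size S ∎)
    where
    open ≡-Reasoning
    carry : Fin p → ℕ
    carry = proj₁ ∘ toℕ-rot-mod
    weight : Fin p → ℕ
    weight a = indicator (S a) * carry a
    eq₁ : ∀ s r p c → s * r + p * (s * c) ≡ s * (r + c * p)
    eq₁ = solve-∀
    eq₂ : ∀ s r → s * suc r ≡ s * r + s
    eq₂ = solve-∀

  mean-rot : ∀ {S S′} → 0 < size S → size S < p → S′ rotates S → mean S′ ≡ rot (mean S)
  mean-rot {S} {S′} 0<S S<p e =
    trans (cong (λ z → residue (inv z * moment S′)) (size-rot {S} {S′} e))
          (scale-step (size S) (inv (size S)) (inv-inverse (size S) 0<S S<p) (moment-rot {S} {S′} e))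

  size-cong : ∀ {S S′ : Fin p → Bool} → S ≗ S′ → size S ≡ size S′
  size-cong e = sum-cong-≗ (cong indicator ∘ e)

  mean-cong : ∀ {S S′} → S ≗ S′ → mean S ≡ mean S′
  mean-cong {S} {S′} e = cong₂ (λ a b → residue (inv a * b)) (size-cong {S} {S′} e)
    (sum-cong-≗ (λ a → cong (λ b → indicator b * toℕ a) (e a)))

  Proper : ℕ → Set
  Proper s = 0 < s × s < p

  ifProper : ℕ → Fin p → Fin p → Fin p
  ifProper s a d with (0 <? s) ×-dec (s <? p)
  ... | yes _ = a
  ... | no  _ = d

  ifProper-rel : {R : Fin p → Fin p → Set} → ∀ s {a a′ d d′} → (Proper s → R a a′) → (¬ Proper s → R d d′) →
                 R (ifProper s a d) (ifProper s a′ d′)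
  ifProper-rel s f g with (0 <? s) ×-dec (s <? p)
  ... | yes pr = f pr
  ... | no ¬pr = g ¬pr

  pick : ∀ {t} → (Fin t → Fin p → Bool) → Fin p → Fin p
  pick {zero}  S d = d
  pick {suc t} S d = ifProper (size (S zero)) (mean (S zero)) (pick (S ∘ suc) d)

  pick-rot : ∀ {t} {S S′ : Fin t → Fin p → Bool} {d d′} → (∀ i → S′ i rotates S i) → d′ ≡ rot d →
             pick S′ d′ ≡ rot (pick S d)
  pick-rot {zero}  e f = f
  pick-rot {suc t} {S} {S′} {d} {d′} e f = trans
    (cong (λ s → ifProper s (mean (S′ zero)) (pick (S′ ∘ suc) d′)) (size-rot {S zero} {S′ zero} (e zero)))
    (ifProper-rel {R = λ a b → a ≡ rot b} (size (S zero))
      (λ (l , u) → mean-rot {S zero} {S′ zero} l u (e zero))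
      (λ _ → pick-rot {S = S ∘ suc} {S′ ∘ suc} (e ∘ suc) f))

  -- The default is reached only if no set is proper, so one of the two suffices: a proper set or
  -- equal defaults.
  pick-cong : ∀ {t} {S S′ : Fin t → Fin p → Bool} {d d′} → (∀ i → S i ≗ S′ i) →
              (∃ λ i → Proper (size (S i))) ⊎ d ≡ d′ → pick S d ≡ pick S′ d′
  pick-cong {zero}  e (inj₂ f) = f
  pick-cong {suc t} {S} {S′} {d} {d′} e ex = trans
    (ifProper-rel {R = _≡_} (size (S zero)) (λ _ → mean-cong {S zero} {S′ zero} (e zero))
      (λ ¬pr → pick-cong {S = S ∘ suc} {S′ ∘ suc} (e ∘ suc) (tail ¬pr ex)))
    (cong (λ s → ifProper s (mean (S′ zero)) (pick (S′ ∘ suc) d′)) (size-cong {S zero} {S′ zero} (e zero)))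
    where
    tail : ∀ {C : Set} → ¬ Proper (size (S zero)) → (∃ λ i → Proper (size (S i))) ⊎ C →
           (∃ λ i → Proper (size (S (suc i)))) ⊎ C
    tail ¬pr (inj₁ (zero  , pr)) = contradiction pr ¬pr
    tail ¬pr (inj₁ (suc i , pr)) = inj₁ (i , pr)
    tail ¬pr (inj₂ f)            = inj₂ f

-- Prime numbers of parts

¬¬-∀-Fin : ∀ {n} {A : Fin n → Set} → (∀ i → ¬ ¬ A i) → ¬ ¬ (∀ i → A i)
¬¬-∀-Fin {zero}  f k = k λ ()
¬¬-∀-Fin {suc n} f k = f zero λ a → ¬¬-∀-Fin (f ∘ suc) λ as → k λ { zero → a ; (suc i) → as i }

-- As there are finitely many subsets, P may be assumed decidable in the proof of a negation.
¬¬-∀-Subset : ∀ {n} {A : Subset n → Set} → (∀ S → ¬ ¬ A S) → ¬ ¬ (∀ S → A S)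
¬¬-∀-Subset {zero}  f k = f [] λ a → k λ { [] → a }
¬¬-∀-Subset {suc n} f k =
  ¬¬-∀-Subset (f ∘ (true ∷_)) λ g → ¬¬-∀-Subset (f ∘ (false ∷_)) λ h →
  k λ { (true ∷ S) → g S ; (false ∷ S) → h S }

-- P j S stands for: S contains a member of 𝓕 of colour j, up to ⌊s/2⌋ missing elements.
Property : ℕ → ℕ → Set₁
Property t n = Fin t → Subset n → Set

UpClosed : ∀ {t n} → Property t n → Set
UpClosed P = ∀ {j A B} → A ⊆ B → P j A → P j B

Disjoint : ∀ {n} → Subset n → Subset n → Set
Disjoint A B = ∀ {x} → x ∈ A → ¬ x ∈ B

DisjointFamily : ∀ {t n} → ℕ → Property t n → Fin t → Set
DisjointFamily {n = n} r P j = ∃ λ (A : Fin r → Subset n) →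
  (∀ i → P j (A i)) × (∀ {i i′} → ¬ i ≡ i′ → Disjoint (A i) (A i′))

Avoids : ∀ {t n r} → Property t n → Labelling r n → Set
Avoids P v = ∀ j i → ¬ P j (class v (suc i))

avoids-≼ : ∀ {t n r} {P : Property t n} → UpClosed P →
           {v w : Labelling r n} → v ≼ w → Avoids P w → Avoids P v
avoids-≼ up v≼w av j i pv = av j i (up (≼⇒⊆ v≼w i) pv)

BalancedAvoiding : ∀ {t n} → ℕ → ℕ → Property t n → Set
BalancedAvoiding {n = n} r d P = ∃ λ (v : Labelling r n) → Balanced v × card v zero ≤ d × Avoids P v

-- Stated for upward closed properties rather than for families, so that `kneserBound-*` can apply
-- it to a derived property.
KneserBound : ℕ → Set₁
KneserBound r = ∀ {t n} (P : Property t n) → UpClosed P →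
  ¬ ¬ ((∃ λ j → DisjointFamily r P j) ⊎ BalancedAvoiding r (pred r * t) P)

module _ (q : ℕ) (p-prime : Prime (suc q)) {t n : ℕ} (P : Property t (suc n)) (up : UpClosed P)
         (P? : ∀ j A → Dec (P j A)) (few : q * t ≤ n)
         (no-family : ∀ j → ¬ DisjointFamily (suc q) P j)
         (no-labelling : ¬ BalancedAvoiding (suc q) (q * t) P) where
  open Rotation q
  open Signed q
  open Select q p-prime

  private
    -- What the rank range {1, ..., n} leaves for the levels once `q * t` is reserved for the
    -- weight.
    α : ℕ
    α = n ∸ q * t

    count : V (suc n) → Fin p → ℕ
    count X a = card X (suc a)

    least : V (suc n) → ℕ
    least X = count X (proj₁ (extremum ≤-total ≤-trans (count X)))

    least≤ : ∀ X a → least X ≤ count X a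
    least≤ X = proj₂ (extremum ≤-total ≤-trans (count X))

    least-glb : ∀ X {k} → (∀ a → k ≤ count X a) → k ≤ least X
    least-glb X le = le _

    -- The part sizes of a largest subvector whose parts differ by at most one.
    level : V (suc n) → Fin p → ℕ
    level X a = count X a ⊓ suc (least X)

    least≤level : ∀ X a → least X ≤ level X a
    least≤level X a = ⊓-glb (least≤ X a) (n≤1+n _)

    least-attained : ∀ X → ∃ λ a → level X a ≡ least X
    least-attained X = _ , m≤n⇒m⊓n≡m (n≤1+n _)

    colours : V (suc n) → Fin t → Fin p → Bool
    colours X j a = does (P? j (class X (suc a)))

    -- Never full, since a smallest part is missing, and empty exactly when all parts have equal
    -- size.
    surplus : V (suc n) → Fin p → Bool
    surplus X a = does (least X <? level X a)

    firstSign : ∀ {m} → V m → Fin p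
    firstSign []          = zero
    firstSign (zero ∷ X)  = firstSign X
    firstSign (suc a ∷ X) = a

    -- Colour sets come first. For an avoiding vector the surplus decides, and if all its parts are
    -- equal in size, the first nonzero entry.
    sign : V (suc n) → Fin p
    sign X = pick (colours X) (pick {1} (λ _ → surplus X) (firstSign X))

    weight : V (suc n) → ℕ
    weight X = sum (size ∘ colours X)

    -- The cap α only matters when some colour occurs, by level-small.
    rank : V (suc n) → ℕ
    rank X = sum (level X) ⊓ α + weight X

    class-rot : ∀ {m} (X : V m) a → class (rotV X) (suc (rot a)) ≡ class X (suc a)
    class-rot []      a = refl
    class-rot (x ∷ X) a = cong₂ _∷_ (entry x) (class-rot X a)
      where
      entry : ∀ x → does (rot₀ x Fin.≟ suc (rot a)) ≡ does (x Fin.≟ suc a)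
      entry zero    = refl
      entry (suc b) with b Fin.≟ a
      ... | yes refl = dec-true (rot b Fin.≟ rot b) refl
      ... | no  b≢a  = dec-false (rot b Fin.≟ rot a) (b≢a ∘ rot-injective)

    count-rot : ∀ X a → count (rotV X) (rot a) ≡ count X a
    count-rot X a = cong ∣_∣ (class-rot X a)

    count-rot′ : ∀ X a → ∃ λ b → count (rotV X) a ≡ count X b
    count-rot′ X a = b , trans (cong (count (rotV X)) (sym rot-b)) (count-rot X b)
      where
      b = iter rot q a
      rot-b : rot b ≡ a
      rot-b = trans (sym (iter-+ rot q 1 a)) (trans (cong (λ k → iter rot k a) (+-comm q 1)) (rot-order a))

    least-rot : ∀ X → least (rotV X) ≡ least X
    least-rot X = ≤-antisym
      (least-glb X λ a → ≤-trans (least≤ (rotV X) (rot a)) (≤-reflexive (count-rot X a)))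
      (least-glb (rotV X) λ a → ≤-trans (least≤ X (proj₁ (count-rot′ X a)))
                                        (≤-reflexive (sym (proj₂ (count-rot′ X a)))))

    sign-equivariant : Equivariant sign
    sign-equivariant {X} nX = pick-rot {S = colours X} {colours (rotV X)}
      (λ j a → cong (λ A → does (P? j A)) (class-rot X a))
      (pick-rot {1} {λ _ → surplus X} {λ _ → surplus (rotV X)}
        (λ _ a → cong₂ (λ h c → does (h <? c ⊓ suc h)) (least-rot X) (count-rot X a))
        (first nX))
      where
      first : ∀ {m} {X : V m} → Nonnull X → firstSign (rotV X) ≡ rot (firstSign X)
      first {X = zero ∷ X}  (here x≢0) = contradiction refl x≢0
      first {X = zero ∷ X}  (there nX) = first nX
      first {X = suc a ∷ X} _          = refl

    colours-mono : ∀ {X Y} → X ≼ Y → ∀ j a → indicator (colours X j a) ≤ indicator (colours Y j a)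
    colours-mono {X} {Y} X≼Y j a with P? j (class X (suc a)) | P? j (class Y (suc a))
    ... | no _   | _      = z≤n
    ... | yes _  | yes _  = ≤-refl
    ... | yes pX | no ¬pY = contradiction (up (≼⇒⊆ X≼Y a) pX) ¬pY

    least-mono : ∀ {X Y} → X ≼ Y → least X ≤ least Y
    least-mono {X} {Y} X≼Y = least-glb Y λ a → ≤-trans (least≤ X a) (card-mono X≼Y a)

    level-mono : ∀ {X Y} → X ≼ Y → ∀ a → level X a ≤ level Y a
    level-mono {X} {Y} X≼Y a = ⊓-mono-≤ (card-mono X≼Y a) (s≤s (least-mono X≼Y))

    -- All p parts with colour j would be the excluded disjoint family.
    size-colours : ∀ X j → size (colours X j) ≤ q
    size-colours X j = ≤-pred (≤∧≢⇒< (size≤ (colours X j)) λ e → no-family j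
      (class X ∘ suc , (λ a → holds a (size≡n⇒ (colours X j) e a)) ,
       λ a≢b → class-disjoint X (a≢b ∘ Fin.suc-injective)))
      where
      holds : ∀ a → colours X j a ≡ true → P j (class X (suc a))
      holds a e with P? j (class X (suc a))
      ... | yes pX = pX

    weight≤ : ∀ X → weight X ≤ q * t
    weight≤ X = ≤-trans (sum-mono (size-colours X)) (≤-reflexive (trans (sum-const t q) (*-comm t q)))

    weight≡0⇒avoids : ∀ X → weight X ≡ 0 → Avoids P X
    weight≡0⇒avoids X e j a pX with trans (sym (dec-true (P? j _) pX))
                                          (size≡0⇒ (colours X j) (sum≡0⇒ (size ∘ colours X) e j) a)
    ... | ()

    -- Otherwise the truncation of X just above its smallest part is the excluded labelling: at
    -- least α + 1 of the n + 1 points keep their label.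
    level-small : ∀ X → Avoids P X → sum (level X) ≤ α
    level-small X av = ≮⇒≥ λ α<lev → no-labelling (Y , balanced , zeros α<lev , avoids-≼ {P = P} up (truncate-≼ _ X) av)
      where
      Y = truncate (suc (least X)) X
      count-Y : ∀ a → count Y a ≡ level X a
      count-Y = card-truncate (suc (least X)) X
      balanced : Balanced Y
      balanced a b rewrite count-Y a | count-Y b = ≤-trans (m⊓n≤n (count X a) _) (s≤s (least≤level X b))
      zeros : α < sum (level X) → card Y zero ≤ q * t
      zeros α<lev = +-cancelʳ-≤ (suc α) _ _ (begin
        card Y zero + suc α             ≤⟨ +-monoʳ-≤ (card Y zero) α<lev ⟩
        card Y zero + sum (level X)     ≡⟨ cong (card Y zero +_) (sym (sum-cong-≗ count-Y)) ⟩
        sum (card Y)                    ≡⟨ sum-card Y ⟩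
        suc n                           ≡⟨ cong suc (sym (m+[n∸m]≡n few)) ⟩
        suc (q * t + α)                 ≡⟨ sym (+-suc (q * t) α) ⟩
        q * t + suc α                   ∎)
        where open ≤-Reasoning

    rank-range : ∀ {X} → Nonnull X → 1 ≤ rank X × rank X ≤ n
    rank-range {X} nX = positive ,
      ≤-trans (+-mono-≤ (m⊓n≤n (sum (level X)) α) (weight≤ X)) (≤-reflexive (m∸n+n≡m few))
      where
      some : ∀ {m} {X : V m} → Nonnull X → ∃ λ a → 0 < card X (suc a)
      some {X = zero ∷ X}  (here x≢0) = contradiction refl x≢0
      some {X = suc a ∷ X} (here _)   = a , subst (0 <_) (sym (card-hit (suc a) X)) z<s
      some {X = x ∷ X}     (there i)  with some i
      ... | a , l = a , ≤-trans l (≤-trans (m≤n+m _ _) (≤-reflexive (sym (card-∷ x X (suc a)))))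
      positive : 1 ≤ rank X
      positive with weight X in e
      ... | suc w = ≤-trans (s≤s z≤n) (m≤n+m (suc w) (sum (level X) ⊓ α))
      ... | zero  with some nX
      ...   | a , l = ≤-trans (≤-trans (⊓-glb l (s≤s z≤n)) (term≤sum (level X) a))
                       (≤-trans (≤-reflexive (sym (m≤n⇒m⊓n≡m (level-small X (weight≡0⇒avoids X e))))) (m≤m+n _ 0))

    rank-mono : ∀ {X Y} → X ≼ Y → rank X ≤ rank Y × (rank X ≡ rank Y → sign X ≡ sign Y)
    rank-mono {X} {Y} X≼Y = +-mono-≤ levels weights , same
      where
      levels  = ⊓-monoˡ-≤ α (sum-mono (level-mono X≼Y))
      sizes : ∀ j → size (colours X j) ≤ size (colours Y j)
      sizes j = sum-mono (colours-mono X≼Y j)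
      weights = sum-mono sizes
      same : rank X ≡ rank Y → sign X ≡ sign Y
      same e = pick-cong {S = colours X} {colours Y} colours-≡ (default (weight X) refl)
        where
        weights-≡ = proj₂ (+-mono-≡ levels weights e)
        colours-≡ : ∀ j a → colours X j a ≡ colours Y j a
        colours-≡ j a = indicator-injective (sum-mono-≡ (colours-mono X≼Y j) (sum-mono-≡ sizes weights-≡ j) a)
        default : ∀ w → weight X ≡ w → (∃ λ j → Proper (size (colours X j))) ⊎
                  pick {1} (λ _ → surplus X) (firstSign X) ≡ pick {1} (λ _ → surplus Y) (firstSign Y)
        -- Positive weight makes some colour set nonempty, and no colour set is full.
        default (suc w) e with sum>0⇒ (size ∘ colours X) (subst (0 <_) (sym e) z<s)
        ... | j , l = inj₁ (j , l , s≤s (size-colours X j))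
        default zero w≡0 = inj₂ (pick-cong {1} {λ _ → surplus X} {λ _ → surplus Y} (λ _ a → surplus-≡ a) first)
          where
          levels-≡ : ∀ a → level X a ≡ level Y a
          -- Both vectors avoid P, so the cap α is inactive and the sums of levels themselves agree.
          levels-≡ = sum-mono-≡ (level-mono X≼Y) (trans (sym (m≤n⇒m⊓n≡m (level-small X (weight≡0⇒avoids X w≡0))))
            (trans (proj₁ (+-mono-≡ levels weights e))
                   (m≤n⇒m⊓n≡m (level-small Y (weight≡0⇒avoids Y (trans (sym weights-≡) w≡0))))))
          least-≡ : least X ≡ least Y
          least-≡ with least-attained X
          ... | a , att = ≤-antisym (least-mono X≼Y)
            (≤-trans (least≤level Y a) (≤-reflexive (trans (sym (levels-≡ a)) att)))
          surplus-≡ : ∀ a → surplus X a ≡ surplus Y a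
          surplus-≡ a = cong₂ (λ h l → does (h <? l)) least-≡ (levels-≡ a)
          first : (∃ λ (i : Fin 1) → Proper (size (surplus X))) ⊎ firstSign X ≡ firstSign Y
          first with size (surplus X) in s-eq
          ... | suc s = inj₁ (zero , z<s , ≤∧≢⇒< (subst (_≤ p) s-eq (size≤ (surplus X))) not-full)
            where
            not-full : ¬ suc s ≡ p
            not-full f with least-attained X
            ... | a , att with trans (sym (size≡n⇒ (surplus X) (trans s-eq f) a))
                                     (dec-false (least X <? level X a) (<-irrefl (sym att)))
            ...   | ()
          -- Without surplus all parts of X and of Y have the same size, and X ≼ Y forces X = Y.
          ... | zero  = inj₂ (cong firstSign (≼∧card-≡⇒≡ X≼Y λ a →
                          trans (flat X (size≡0⇒ (surplus X) s-eq) a)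
                          (trans least-≡ (sym (flat Y (λ b → trans (sym (surplus-≡ b)) (size≡0⇒ (surplus X) s-eq b)) a)))))
            where
            flat : ∀ X → (∀ a → surplus X a ≡ false) → ∀ a → count X a ≡ least X
            flat X none a = ≤-antisym (≮⇒≥ λ l → true≢false (trans (sym (dec-true (_ <? _) (⊓-glb l ≤-refl))) (none a)))
                                      (least≤ X a)
              where
              true≢false : ¬ true ≡ false
              true≢false ()

  no-counterexample : ⊥
  no-counterexample = tucker n sign rank (λ { refl → ¬prime[1] p-prime }) sign-equivariant rank-range (λ _ _ → rank-mono)

kneserBound-prime : ∀ {p} → Prime p → KneserBound p
kneserBound-prime {zero}  pr = contradiction pr ¬prime[0]
kneserBound-prime {suc q} pr {t} {n} P up k =
  ¬¬-∀-Fin {A = λ j → ∀ A → Dec (P j A)} (λ j → ¬¬-∀-Subset λ A → ¬¬-excluded-middle) (by-size n P up k)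
  where
  by-size : ∀ n (P : Property t n) (up : UpClosed P) →
    ¬ ((∃ λ j → DisjointFamily (suc q) P j) ⊎ BalancedAvoiding (suc q) (q * t) P) → ¬ (∀ j A → Dec (P j A))
  by-size n P up k P? with n ≤? q * t
  -- So few points can all be deleted.
  by-size n P up k P? | yes n≤qt = k (inj₂ (Vec.replicate n zero , balanced , zeros , avoids))
    where
    none : ∀ n i → class (Vec.replicate n (zero {suc q})) (suc i) ≡ Subset.⊥
    none n i = Vec.map-replicate _ zero n
    cards : ∀ n i → card (Vec.replicate n (zero {suc q})) (suc i) ≡ 0
    cards n i = trans (cong ∣_∣ (none n i)) (∣⊥∣≡0 n)
    balanced : Balanced (Vec.replicate n (zero {suc q}))
    balanced i j rewrite cards n i = z≤n
    zeros : card (Vec.replicate n (zero {suc q})) zero ≤ q * t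
    zeros = ≤-trans (∣p∣≤n (class (Vec.replicate n zero) zero)) n≤qt
    avoids : Avoids P (Vec.replicate n (zero {suc q}))
    -- If the empty set had the property, copies of it would be a disjoint family.
    avoids j i pi = k (inj₁ (j , (λ _ → Subset.⊥) , (λ _ → subst (P j) (none n i) pi) , λ _ x∈⊥ _ → ∉⊥ x∈⊥))
  by-size zero    P up k P? | no n≰ = n≰ z≤n
  by-size (suc n) P up k P? | no n≰ =
    no-counterexample q pr P up P? (≤-pred (≰⇒> n≰)) (λ j f → k (inj₁ (j , f))) (k ∘ inj₂)

-- Composite numbers of parts

drop-one : ∀ {r n} (v : Labelling r n) i → 0 < card v (suc i) →
  ∃ λ w → w ≼ v × card w zero ≡ suc (card v zero) × suc (card w (suc i)) ≡ card v (suc i) ×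
          (∀ j → ¬ i ≡ j → card w (suc j) ≡ card v (suc j))
drop-one {r} {suc n} (x ∷ v) i pos = go (x Fin.≟ suc i)
  where
  go : Dec (x ≡ suc i) → ∃ λ w → w ≼ (x ∷ v) × card w zero ≡ suc (card (x ∷ v) zero) ×
       suc (card w (suc i)) ≡ card (x ∷ v) (suc i) × (∀ j → ¬ i ≡ j → card w (suc j) ≡ card (x ∷ v) (suc j))
  go (yes refl) = zero ∷ v , inj₁ refl ∷ ≼-refl , refl , sym (card-hit (suc i) v) ,
                  λ j i≢j → sym (card-miss v (i≢j ∘ Fin.suc-injective))
  go (no x≢i) with drop-one v i (subst (0 <_) (card-miss v x≢i) pos)
  ... | w , le , z , at , other = x ∷ w , inj₂ refl ∷ le ,
      trans (card-∷ x w zero) (trans (cong (indicator (does (x Fin.≟ zero)) +_) z)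
        (trans (+-suc _ _) (cong suc (sym (card-∷ x v zero))))) ,
      trans (cong suc (card-miss w x≢i)) (trans at (sym (card-miss v x≢i))) ,
      λ j i≢j → trans (card-∷ x w (suc j)) (trans (cong (indicator (does (x Fin.≟ suc j)) +_) (other j i≢j))
        (sym (card-∷ x v (suc j))))

shrink-one : ∀ {b n} (v : Labelling (suc b) n) → Balanced v → card v zero < n →
  ∃ λ w → w ≼ v × Balanced w × card w zero ≡ suc (card v zero)
shrink-one {b} {n} v bal lt with extremum {R = _≥_} (λ x y → ≤-total y x) (λ p q → ≤-trans q p) (card v ∘ suc)
... | i , max with drop-one v i pos
  where
  pos : 0 < card v (suc i)
  -- If a largest part were empty, all n points would already be deleted.
  pos = n≢0⇒n>0 λ e → <⇒≢ lt (trans (sym (+-identityʳ _)) (trans (cong (card v zero +_) (sym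
    (n≤0⇒n≡0 (≤-trans (sum-mono (λ j → ≤-trans (max j) (≤-reflexive e)))
      (≤-reflexive (trans (sum-const (suc b) 0) (*-zeroʳ (suc b)))))))) (sum-card v)))
... | w , le , z , e , other = w , le , bal′ , z
  where
  bal′ : Balanced w
  bal′ j k with i Fin.≟ k
  ... | yes refl = ≤-trans (card-mono le j) (≤-trans (max j) (≤-reflexive (sym e)))
  ... | no i≢k   = ≤-trans (card-mono le j) (≤-trans (bal j k) (s≤s (≤-reflexive (sym (other k i≢k)))))

shrink : ∀ {b n} k (v : Labelling (suc b) n) → Balanced v → card v zero + k ≤ n →
  ∃ λ w → w ≼ v × Balanced w × card w zero ≡ card v zero + k
shrink zero    v bal le = v , ≼-refl , bal , sym (+-identityʳ _)
shrink (suc k) v bal le with shrink-one v bal (≤-trans (≤-trans (s≤s (m≤m+n _ k)) (≤-reflexive (sym (+-suc _ k)))) le)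
... | w , w≼v , bal-w , z with shrink k w bal-w (≤-trans (≤-reflexive (trans (cong (_+ k) z) (sym (+-suc _ k)))) le)
...   | u , u≼w , bal-u , y = u , ≼-trans u≼w w≼v , bal-u , trans y (trans (cong (_+ k) z) (sym (+-suc _ k)))

-- Carries vectors on the points of N, numbered in order, back to [n]; thus the bound can be applied
-- with a part as ground set.
expand : ∀ {n} {A : Set} → A → (N : Subset n) → Vec A ∣ N ∣ → Vec A n
expand a []          v       = []
expand a (true ∷ N)  (x ∷ v) = x ∷ expand a N v
expand a (false ∷ N) v       = a ∷ expand a N v

∈-expand : ∀ {n} (N : Subset n) (A : Subset ∣ N ∣) {x} → x ∈ expand false N A →
  x ∈ N × ∃ λ y → y ∈ A × (∀ B → y ∈ B → x ∈ expand false N B) × (∀ B → x ∈ expand false N B → y ∈ B)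
∈-expand (true ∷ N) (true ∷ A) here =
  here , zero , here , (λ { (_ ∷ B) here → here }) , (λ { (_ ∷ B) here → here })
∈-expand (true ∷ N) (a ∷ A) (there i) with ∈-expand N A i
... | x∈N , y , y∈A , f , g =
  there x∈N , suc y , there y∈A , (λ { (_ ∷ B) (there j) → there (f B j) }) , (λ { (_ ∷ B) (there j) → there (g B j) })
∈-expand (false ∷ N) A (there i) with ∈-expand N A i
... | x∈N , y , y∈A , f , g = there x∈N , y , y∈A , (λ B j → there (f B j)) , (λ { B (there j) → g B j })

expand-⊆ : ∀ {n} (N : Subset n) A → expand false N A ⊆ N
expand-⊆ N A i = proj₁ (∈-expand N A i)

expand-mono : ∀ {n} (N : Subset n) {A B} → A ⊆ B → expand false N A ⊆ expand false N B
expand-mono N {A} {B} A⊆B i with ∈-expand N A i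
... | _ , y , y∈A , f , _ = f B (A⊆B y∈A)

expand-disjoint : ∀ {n} (N : Subset n) {A B} → Disjoint A B → Disjoint (expand false N A) (expand false N B)
expand-disjoint N {A} {B} dis i j with ∈-expand N A i
... | _ , y , y∈A , _ , g = dis y∈A (g B j)

∣expand∣ : ∀ {n} (N : Subset n) A → ∣ expand false N A ∣ ≡ ∣ A ∣
∣expand∣ []          []          = refl
∣expand∣ (true ∷ N)  (true ∷ A)  = cong suc (∣expand∣ N A)
∣expand∣ (true ∷ N)  (false ∷ A) = ∣expand∣ N A
∣expand∣ (false ∷ N) A           = ∣expand∣ N A

class-expand : ∀ {n r} (N : Subset n) (v : Labelling r ∣ N ∣) i →
  class (expand zero N v) (suc i) ≡ expand false N (class v (suc i))
class-expand []          []      i = refl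
class-expand (true ∷ N)  (x ∷ v) i = cong (_ ∷_) (class-expand N v i)
class-expand (false ∷ N) v       i = cong (false ∷_) (class-expand N v i)

sum-++ : ∀ m n (f : Fin (m + n) → ℕ) → sum f ≡ sum (f ∘ (_↑ˡ n)) + sum (f ∘ (m ↑ʳ_))
sum-++ zero    n f = refl
sum-++ (suc m) n f = trans (cong (f zero +_) (sum-++ m n (f ∘ suc))) (sym (+-assoc (f zero) _ _))

sum-combine : ∀ a b (f : Fin (a * b) → ℕ) → sum f ≡ sum {a} (λ i → sum {b} (λ k → f (combine i k)))
sum-combine zero    b f = refl
sum-combine (suc a) b f = trans (sum-++ b (a * b) f) (cong (sum (f ∘ (_↑ˡ (a * b))) +_) (sum-combine a b (f ∘ (b ↑ʳ_))))

module _ {a b n : ℕ} (v : Labelling a n) (w : ∀ i → Labelling b ∣ class v (suc i) ∣) where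

  private
    inner : Fin a → Labelling b n
    inner i = expand zero (class v (suc i)) (w i)

    join : Fin (suc a) → (Fin a → Fin (suc b)) → Fin (suc (a * b))
    join zero    f = zero
    join (suc i) f with f i
    ... | zero  = zero
    ... | suc k = suc (combine i k)

    join⁺ : ∀ {x f i k} → x ≡ suc i → f i ≡ suc k → join x f ≡ suc (combine i k)
    join⁺ {f = f} refl e rewrite e = refl

    join⁻ : ∀ x {f i k} → join x f ≡ suc (combine i k) → f i ≡ suc k
    join⁻ (suc i′) {f} {i} {k} e with f i′ in f-eq
    ... | suc k′ with Fin.combine-injective i′ k′ i k (Fin.suc-injective e)
    ...   | refl , refl = f-eq

  refine : Labelling (a * b) n
  refine = tabulate λ x → join (lookup v x) (λ i → lookup (inner i) x)

  class-refine : ∀ i k → class refine (suc (combine i k)) ≡ expand false (class v (suc i)) (class (w i) (suc k))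
  class-refine i k = trans (⊆-antisym fwd bwd) (class-expand (class v (suc i)) (w i) k)
    where
    at : ∀ x → lookup refine x ≡ join (lookup v x) (λ i → lookup (inner i) x)
    at x = Vec.lookup∘tabulate _ x
    fwd : class refine (suc (combine i k)) ⊆ class (inner i) (suc k)
    fwd {x} m = ∈-class⁺ (inner i)
      (join⁻ (lookup v x) {λ i → lookup (inner i) x} (trans (sym (at x)) (∈-class⁻ refine m)))
    bwd : class (inner i) (suc k) ⊆ class refine (suc (combine i k))
    bwd {x} m = ∈-class⁺ refine (trans (at x) (join⁺ {f = λ i → lookup (inner i) x}
      (∈-class⁻ v (expand-⊆ (class v (suc i)) _ (subst (x ∈_) (class-expand (class v (suc i)) (w i) k) m)))
      (∈-class⁻ (inner i) m)))

  card-refine : ∀ i k → card refine (suc (combine i k)) ≡ card (w i) (suc k)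
  card-refine i k = trans (cong ∣_∣ (class-refine i k)) (∣expand∣ (class v (suc i)) (class (w i) (suc k)))

  -- Counted through the complement: the other classes are known by `card-refine`, and all classes
  -- together make n.
  card-refine-zero : card refine zero ≡ card v zero + sum (λ i → card (w i) zero)
  card-refine-zero = +-cancelʳ-≡ total _ _ (begin
    card refine zero + total                                ≡⟨ cong (card refine zero +_) parts ⟩
    card refine zero + sum (card refine ∘ suc)              ≡⟨ sum-card refine ⟩
    n                                                       ≡⟨ sym (sum-card v) ⟩
    card v zero + sum (λ i → card v (suc i))
      ≡⟨ cong (card v zero +_) (sum-cong-≗ λ i → sym (sum-card (w i))) ⟩
    card v zero + sum (λ i → card (w i) zero + sum (card (w i) ∘ suc))
      ≡⟨ cong (card v zero +_) (∑-distrib-+ (λ i → card (w i) zero) (λ i → sum (card (w i) ∘ suc))) ⟩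
    card v zero + (sum (λ i → card (w i) zero) + total)     ≡⟨ sym (+-assoc (card v zero) _ _) ⟩
    card v zero + sum (λ i → card (w i) zero) + total       ∎)
    where
    open ≡-Reasoning
    total = sum (λ i → sum (card (w i) ∘ suc))
    parts : total ≡ sum (card refine ∘ suc)
    parts = sym (trans (sum-combine a b (card refine ∘ suc)) (sum-cong-≗ λ i → sum-cong-≗ λ k → card-refine i k))

-- If f i were at least g j + 2, all f would be at least g j + 1 and all g at most g j + 1, strictly
-- at i and at j, so the sums would differ by two or more.
balanced-sums : ∀ {b} (f g : Fin b → ℕ) → (∀ i j → f i ≤ suc (f j)) → (∀ i j → g i ≤ suc (g j)) →
                sum f ≤ suc (sum g) → ∀ i j → f i ≤ suc (g j)
balanced-sums f g bf bg le i j = ≮⇒≥ λ lt →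
  <⇒≱ (≤-<-trans (sum-mono-< {f = g} (λ k → bg k j) j ≤-refl)
                 (sum-mono-< {g = f} (λ k → ≤-pred (≤-trans lt (bf i k))) i lt)) le

kneserBound-1 : KneserBound 1
kneserBound-1 {t} {n} P up k = k (inj₂ (v , (λ { zero zero → n≤1+n _ }) , zeros , avoids))
  where
  v : Labelling 1 n
  v = Vec.replicate n (suc zero)
  zeros : card v zero ≤ 0
  zeros = go n
    where
    go : ∀ n → card {1} (Vec.replicate n (suc zero)) zero ≤ 0
    go zero    = z≤n
    go (suc n) = go n
  avoids : Avoids P v
  avoids j zero pj = k (inj₁ (j , (λ _ → class v (suc zero)) , (λ _ → pj) ,
    λ { {zero} {zero} 0≢0 → contradiction refl 0≢0 }))

-- The outer bound is applied to the property Q of containing b + 1 disjoint sets of one colour, the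
-- inner bound to P within each outer part. The removals add up: a t + (a + 1) b t = ((a + 1)(b + 1)
-- - 1) t.
kneserBound-* : ∀ a b → KneserBound (suc a) → KneserBound (suc b) → KneserBound (suc a * suc b)
kneserBound-* a b boundA boundB {t} {n} P up k = boundA Q up-Q λ
  { (inj₁ (j , A , q , dis)) → k (inj₁ (j , flatten j A q dis))
  ; (inj₂ (v , bal , zeros , avoids)) → ¬¬-∀-Fin (inside v avoids) λ w → k (inj₂ (assemble v bal zeros w)) }
  where
  Q : Property t n
  Q j N = ∃ λ (F : DisjointFamily (suc b) P j) → ∀ k → proj₁ F k ⊆ N

  up-Q : UpClosed Q
  up-Q A⊆B (F , sub) = F , λ k → A⊆B ∘ sub k

  P↾ : (N : Subset n) → Property t ∣ N ∣
  P↾ N j A = P j (expand false N A)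

  flatten : ∀ j (A : Fin (suc a) → Subset n) → (∀ i → Q j (A i)) →
            (∀ {i i′} → ¬ i ≡ i′ → Disjoint (A i) (A i′)) →
            DisjointFamily (suc a * suc b) P j
  flatten j A q dis =
    (λ e → B (split e)) , (λ e → holds (split e)) , λ {e} {e′} e≢e′ → apart (split e) (split e′) λ s≡s′ →
      e≢e′ (trans (sym (Fin.combine-remQuot {suc a} (suc b) e))
           (trans (cong (λ (i , k) → combine i k) s≡s′) (Fin.combine-remQuot {suc a} (suc b) e′)))
    where
    split : Fin (suc a * suc b) → Fin (suc a) × Fin (suc b)
    split = Fin.remQuot {suc a} (suc b)
    B : Fin (suc a) × Fin (suc b) → Subset n
    B (i , k) = proj₁ (proj₁ (q i)) k
    holds : ∀ s → P j (B s)
    holds (i , k) = proj₁ (proj₂ (proj₁ (q i))) k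
    apart : ∀ s s′ → ¬ s ≡ s′ → Disjoint (B s) (B s′)
    apart (i , k) (i′ , k′) s≢s′ with i Fin.≟ i′
    ... | no i≢i′  = λ x∈ x∈′ → dis i≢i′ (proj₂ (q i) k x∈) (proj₂ (q i′) k′ x∈′)
    ... | yes refl = proj₂ (proj₂ (proj₁ (q i))) λ k≡k′ → s≢s′ (cong (i ,_) k≡k′)

  -- Removing exactly min(|part|, b t) elements keeps the sizes of the parts within one.
  Inside : Subset n → Set
  Inside N = ∃ λ (w : Labelling (suc b) ∣ N ∣) → Balanced w × card w zero ≡ (b * t) ⊓ ∣ N ∣ × Avoids (P↾ N) w

  inside : ∀ (v : Labelling (suc a) n) → Avoids Q v → ∀ i → ¬ ¬ Inside (class v (suc i))
  inside v avoids i k′ = boundB (P↾ N) (λ A⊆B → up (expand-mono N A⊆B)) λ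
    { (inj₁ (j , A , p , dis)) → avoids j i
        ((expand false N ∘ A , p , λ k≢k′ → expand-disjoint N (dis k≢k′)) , λ k → expand-⊆ N (A k))
    ; (inj₂ (w , bal , zeros , av)) → exact w bal av zeros }
    where
    N = class v (suc i)
    exact : (w : Labelling (suc b) ∣ N ∣) → Balanced w → Avoids (P↾ N) w → card w zero ≤ b * t → ⊥
    exact w bal av le = finish (shrink ((b * t) ⊓ ∣ N ∣ ∸ card w zero) w bal
                                  (≤-trans (≤-reflexive (m+[n∸m]≡n low)) (m⊓n≤n (b * t) ∣ N ∣)))
      where
      low : card w zero ≤ (b * t) ⊓ ∣ N ∣
      low = ⊓-glb le (≤-trans (m≤m+n _ _) (≤-reflexive (sum-card w)))
      finish : ¬ (∃ λ u → u ≼ w × Balanced u × card u zero ≡ card w zero + ((b * t) ⊓ ∣ N ∣ ∸ card w zero))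
      finish (u , u≼w , bal-u , e) = k′ (u , bal-u , trans e (m+[n∸m]≡n low) ,
        avoids-≼ {P = P↾ N} (λ A⊆B → up (expand-mono N A⊆B)) u≼w av)

  assemble : ∀ (v : Labelling (suc a) n) → Balanced v → card v zero ≤ a * t →
             (∀ i → Inside (class v (suc i))) →
             BalancedAvoiding (suc a * suc b) (pred (suc a * suc b) * t) P
  assemble v bal zeros ins = refine v w , balanced , zeros′ , avoids
    where
    w : ∀ i → Labelling (suc b) ∣ class v (suc i) ∣
    w = proj₁ ∘ ins

    removed : ∀ i → card (w i) zero ≡ (b * t) ⊓ card v (suc i)
    removed i = proj₁ (proj₂ (proj₂ (ins i)))

    remaining : ∀ i → sum (card (w i) ∘ suc) ≡ card v (suc i) ∸ b * t
    remaining i = +-cancelˡ-≡ (card (w i) zero) _ _ (trans (sum-card (w i))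
      (trans (sym (m⊓n+n∸m≡n (b * t) (card v (suc i)))) (cong (_+ (card v (suc i) ∸ b * t)) (sym (removed i)))))

    -- Removing min(x, b t) of x points leaves x ∸ b t, and this map does not increase differences.
    remaining-balanced : ∀ i i′ → sum (card (w i) ∘ suc) ≤ suc (sum (card (w i′) ∘ suc))
    remaining-balanced i i′ rewrite remaining i | remaining i′ =
      m≤n+o⇒m∸n≤o (card v (suc i)) (b * t) (≤-trans (bal i i′)
        (≤-trans (s≤s (m≤n+m∸n (card v (suc i′)) (b * t))) (≤-reflexive (sym (+-suc (b * t) _)))))

    balanced : Balanced (refine v w)
    balanced e e′ with Fin.combine-surjective {suc a} {suc b} e | Fin.combine-surjective {suc a} {suc b} e′
    ... | i , k , refl | i′ , k′ , refl rewrite card-refine v w i k | card-refine v w i′ k′ =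
      balanced-sums (card (w i) ∘ suc) (card (w i′) ∘ suc) (proj₁ (proj₂ (ins i))) (proj₁ (proj₂ (ins i′)))
                    (remaining-balanced i i′) k k′

    avoids : Avoids P (refine v w)
    avoids j e pe with Fin.combine-surjective {suc a} {suc b} e
    ... | i , k , refl = proj₂ (proj₂ (proj₂ (ins i))) j k (subst (P j) (class-refine v w i k) pe)

    zeros′ : card (refine v w) zero ≤ (b + a * suc b) * t
    zeros′ = begin
      card (refine v w) zero                            ≡⟨ card-refine-zero v w ⟩
      card v zero + sum (λ i → card (w i) zero)
        ≤⟨ +-mono-≤ zeros (sum-mono λ i → ≤-trans (≤-reflexive (removed i)) (m⊓n≤m (b * t) _)) ⟩
      a * t + sum {suc a} (λ _ → b * t)                 ≡⟨ cong (a * t +_) (sum-const (suc a) (b * t)) ⟩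
      a * t + suc a * (b * t)                           ≡⟨ eq a b t ⟩
      (b + a * suc b) * t                               ∎
      where
      open ≤-Reasoning
      eq : ∀ a b t → a * t + suc a * (b * t) ≡ (b + a * suc b) * t
      eq = solve-∀

kneserBound-product : ∀ {ps} → All Prime ps → KneserBound (product ps)
kneserBound-product []                = kneserBound-1
kneserBound-product {p ∷ ps} (pr ∷ prs) = go p pr (product ps) (productOfPrimes≢0 prs) (kneserBound-product prs)
  where
  go : ∀ p → Prime p → ∀ m → NonZero m → KneserBound m → KneserBound (p * m)
  go zero    pr m       _ bound = contradiction pr ¬prime[0]
  go (suc p) pr (suc m) _ bound = kneserBound-* p m (kneserBound-prime pr) bound

kneserBound : ∀ r .{{_ : NonZero r}} → KneserBound r
kneserBound r = subst KneserBound (sym isFactorisation) (kneserBound-product factorsPrime)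
  where open PrimeFactorisation (factorise r)

-- From the bound for properties to colourings

∣p∪q∣≤∣p∣+∣q∣ : ∀ {n} (p q : Subset n) → ∣ p ∪ q ∣ ≤ ∣ p ∣ + ∣ q ∣
∣p∪q∣≤∣p∣+∣q∣ []          []          = z≤n
∣p∪q∣≤∣p∣+∣q∣ (true ∷ p)  (true ∷ q)  =
  s≤s (≤-trans (∣p∪q∣≤∣p∣+∣q∣ p q) (+-monoʳ-≤ ∣ p ∣ (n≤1+n ∣ q ∣)))
∣p∪q∣≤∣p∣+∣q∣ (true ∷ p)  (false ∷ q) = s≤s (∣p∪q∣≤∣p∣+∣q∣ p q)
∣p∪q∣≤∣p∣+∣q∣ (false ∷ p) (true ∷ q)  =
  ≤-trans (s≤s (∣p∪q∣≤∣p∣+∣q∣ p q)) (≤-reflexive (sym (+-suc ∣ p ∣ ∣ q ∣)))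
∣p∪q∣≤∣p∣+∣q∣ (false ∷ p) (false ∷ q) = ∣p∪q∣≤∣p∣+∣q∣ p q

-- A common point outside both exceptional sets would lie in A and in B.
∣∩∣-almost-disjoint : ∀ {n} s {F G A B : Subset n} →
  F ⊆[ ⌊ s /2⌋ ] A → G ⊆[ ⌊ s /2⌋ ] B → Disjoint A B → ∣ F ∩ G ∣ ≤ s
∣∩∣-almost-disjoint s {F} {G} {A} {B} (E , ∣E∣≤ , F─E⊆A) (E′ , ∣E′∣≤ , G─E′⊆B) dis = begin
  ∣ F ∩ G ∣                  ≤⟨ p⊆q⇒∣p∣≤∣q∣ covered ⟩
  ∣ E ∪ E′ ∣                 ≤⟨ ∣p∪q∣≤∣p∣+∣q∣ E E′ ⟩
  ∣ E ∣ + ∣ E′ ∣             ≤⟨ +-mono-≤ ∣E∣≤ (≤-trans ∣E′∣≤ (⌊n/2⌋≤⌈n/2⌉ s)) ⟩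
  ⌊ s /2⌋ + ⌈ s /2⌉          ≡⟨ ⌊n/2⌋+⌈n/2⌉≡n s ⟩
  s                          ∎
  where
  open ≤-Reasoning
  covered : F ∩ G ⊆ E ∪ E′
  covered {x} m with x∈p∩q⁻ F G m | x ∈? E | x ∈? E′
  ... | _       | yes x∈E | _         = x∈p∪q⁺ (inj₁ x∈E)
  ... | _       | _       | yes x∈E′  = x∈p∪q⁺ (inj₂ x∈E′)
  ... | x∈F , x∈G | no x∉E | no x∉E′ =
    contradiction (G─E′⊆B (x∈p∧x∉q⇒x∈p─q x∈G x∉E′)) (dis (F─E⊆A (x∈p∧x∉q⇒x∈p─q x∈F x∉E)))

part≡class : ∀ {n r} (v : Labelling r n) j → part (lookup v) j ≡ class v j
part≡class v j = trans (Vec.tabulate-∘ (λ x → does (x Fin.≟ j)) (lookup v)) (cong (Vec.map _) (Vec.tabulate∘lookup v))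

⌈/⌉-≤ : ∀ m d k → m ≤ suc d * k → ⌈ m / suc d ⌉ ≤ k
⌈/⌉-≤ m d k le = ≤-pred (m<n*o⇒m/o<n (begin
  suc (m + d)       ≡⟨ sym (+-suc m d) ⟩
  m + suc d         ≤⟨ +-monoˡ-≤ (suc d) le ⟩
  suc d * k + suc d ≡⟨ trans (+-comm _ (suc d)) (cong (suc d +_) (*-comm (suc d) k)) ⟩
  suc k * suc d     ∎))
  where open ≤-Reasoning

theorem3 : (n r s : ℕ) (𝓕 : Family n) → 1 ≤ n → 2 ≤ r →
    (∀ F → 𝓕 F → Nonempty F) → (∀ F → 𝓕 F → s < ∣ F ∣) →
    (m : ℕ) → IsEcd r ⌊ s /2⌋ 𝓕 m →
    (k : ℕ) (c : Subset n → Fin k) → ProperColouring r s 𝓕 k c →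
    ⌈ m / r ∸ 1 ⌉ ≤ k
theorem3 n 1 s 𝓕 _ (s≤s ())
theorem3 n r@(suc (suc d)) s 𝓕 _ _ _ large m (_ , minimal) k c proper =
  -- The goal is decidable, which discharges the double negation in `KneserBound`.
  decidable-stable (_ ≤? k) λ ≰k → kneserBound r P up λ
    { (inj₁ (j , A , p , dis)) → family j A p dis
    ; (inj₂ (v , bal , zeros , avoids)) → ≰k (⌈/⌉-≤ m d k (≤-trans (labelled v bal avoids) zeros)) }
  where
  P : Property k n
  P j A = ∃ λ F → 𝓕 F × c F ≡ j × F ⊆[ ⌊ s /2⌋ ] A

  up : UpClosed P
  up A⊆B (F , F∈ , cF , E , ∣E∣≤ , F─E⊆A) = F , F∈ , cF , E , ∣E∣≤ , A⊆B ∘ F─E⊆A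

  family : ∀ j (A : Fin r → Subset n) → (∀ i → P j (A i)) → ¬ (∀ {i i′} → ¬ i ≡ i′ → Disjoint (A i) (A i′))
  family j A p dis = proper e (inj , (λ i → proj₁ (proj₂ (p i))) , small) λ i i′ → trans (colour i) (sym (colour i′))
    where
    e : Fin r → Subset n
    e i = proj₁ (p i)
    colour : ∀ i → c (e i) ≡ j
    colour i = proj₁ (proj₂ (proj₂ (p i)))
    small : ∀ i i′ → ¬ i ≡ i′ → ∣ e i ∩ e i′ ∣ ≤ s
    small i i′ i≢i′ = ∣∩∣-almost-disjoint s (proj₂ (proj₂ (proj₂ (p i)))) (proj₂ (proj₂ (proj₂ (p i′)))) (dis i≢i′)
    -- Equal members at different indices would meet in the whole set, which has more than s
    -- elements by `large`.
    inj : ∀ {i i′} → e i ≡ e i′ → i ≡ i′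
    inj {i} {i′} eq = decidable-stable (i Fin.≟ i′) λ i≢i′ → <⇒≱ (large (e i) (proj₁ (proj₂ (p i))))
      (subst (λ F → ∣ F ∣ ≤ s) (trans (cong (e i ∩_) (sym eq)) (∩-idem (e i))) (small i i′ i≢i′))

  labelled : ∀ (v : Labelling r n) → Balanced v → Avoids P v → m ≤ card v zero
  labelled v bal avoids = ≤-trans (minimal (lookup v) (equitable , admissible))
                                  (≤-reflexive (cong ∣_∣ (part≡class v zero)))
    where
    equitable : Equitable (lookup v)
    equitable i j rewrite part≡class v (suc i) | part≡class v (suc j) = bal i j
    admissible : ∀ F i → 𝓕 F → ¬ (F ⊆[ ⌊ s /2⌋ ] part (lookup v) (suc i))
    admissible F i F∈ sub = avoids (c F) i (F , F∈ , refl , subst (F ⊆[ ⌊ s /2⌋ ]_) (part≡class v (suc i)) sub)
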